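{- For every oriented matroid $\mathcal{M}$, its tope graph has a reconstructible map; consequently the class of topes $\mathcal{T}(\mathcal{M})$ has a proper unlabeled sample compression scheme of size $\mathrm{vc}(\mathcal{T}(\mathcal{M}))$.
   Context: OM: $(U,\mathcal{L})$, $\mathcal{L}\subseteq\{+,-,0\}^U$, satisfying (C) $X\circ Y\in\mathcal{L}$; (SE) for $X,Y\in\mathcal{L}$, $e\in\mathrm{Sep}(X,Y)$ there is $Z\in\mathcal{L}$ with $Z_e=0$ and $Z_h=(X\circ Y)_h$ for $h\notin\mathrm{Sep}(X,Y)$; (Sym) $-X\in\mathcal{L}$; where $\mathrm{Sep}(X,Y)=\{e:\{X_e,Y_e\}=\{+,-\}\}$ and $(X\circ Y)_e=X_e$ if $X_e\ne0$, else $Y_e$. OMs are assumed simple. Topes: $\mathcal{T}(\mathcal{M})=\mathcal{L}\cap\{+,-\}^U$; the tope graph is the induced subgraph of the hypercube on the topes (a partial cube). For a partial cube $G$ with vertices in $\{+,-\}^U$: halfspaces $H_e^\pm$; convex sets (containing all shortest paths; equivalently intersections of halfspaces) form $\mathcal{H}(G)$; $\mathrm{osc}(C)$ is the set of elements flipped by edges between $C$ and its complement; $\overline{X}(G)$ is the family of subsets of $U$ shattered by the vertex set; $\mathrm{vc}$ is the VC-dimension. A reconstructible map is $a:\mathcal{H}(G)\to\overline{X}(G)$ with (a) $a(C)\subseteq\mathrm{osc}(C)$ and (b) for each $V$ in the image, $\bigcap\{C: a(C)=V\}\ne\emptyset$. For a concept class $\mathcal{C}\subseteq\{+,-\}^U$: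 samples $s\in\{+,-,0\}^U$, support $\underline{s}=\{u:s_u\ne0\}$, realizable if $s\le c$ for some $c\in\mathcal{C}$ (product order from $0\le+,0\le-$), set $\mathrm{RS}(\mathcal{C})$. An unlabeled sample compression scheme of size $k$: maps $\alpha:\mathrm{RS}(\mathcal{C})\to\{A\subseteq U:|A|\le k\}$ and $\beta:\alpha(\mathrm{RS}(\mathcal{C}))\to\{+,-\}^U$ with $\alpha(s)\subseteq\underline{s}$ and $s\le\beta(\alpha(s))$; proper if $\beta$ maps into $\mathcal{C}$. -}

module Defs where

open import Data.Nat using (ℕ; _≤_)
open import Data.Fin using (Fin)
open import Data.Bool using (Bool; true)
open import Data.Vec using (Vec; lookup; map; zipWith; updateAt)
open import Data.List using (List)
import Data.List.Membership.Propositional as LM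
open import Data.Fin.Subset using (Subset; ∣_∣) renaming (_∈_ to _∈ₛ_; _⊆_ to _⊆ₛ_)
open import Data.Product using (Σ; ∃; _×_; _,_)
open import Data.Sum using (_⊎_)
open import Relation.Nullary using (¬_)
open import Level using (0ℓ)
open import Relation.Unary using (Pred)
open import Relation.Binary.PropositionalEquality using (_≡_; _≢_)

data Sign : Set where
  pos neg zer : Sign

data PM : Set where
  ⊕ ⊖ : PM

↑ : PM → Sign
↑ ⊕ = pos
↑ ⊖ = neg

negS : Sign → Sign
negS pos = neg
negS neg = pos
negS zer = zer

flipPM : PM → PM
flipPM ⊕ = ⊖
flipPM ⊖ = ⊕

_∘ₛ_ : Sign → Sign → Sign
pos ∘ₛ _ = pos
neg ∘ₛ _ = neg
zer ∘ₛ y = y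

SignVec : ℕ → Set
SignVec n = Vec Sign n

PMVec : ℕ → Set
PMVec n = Vec PM n

_∘_ : ∀ {n} → SignVec n → SignVec n → SignVec n
X ∘ Y = zipWith _∘ₛ_ X Y

-_ : ∀ {n} → SignVec n → SignVec n
- X = map negS X

Opp : Sign → Sign → Set
Opp a b = (a ≡ pos × b ≡ neg) ⊎ (a ≡ neg × b ≡ pos)

Sep : ∀ {n} → SignVec n → SignVec n → Fin n → Set
Sep X Y e = Opp (lookup X e) (lookup Y e)

module _ {n : ℕ} (ℒ : List (SignVec n)) where
  open LM

  Composition : Set
  Composition = ∀ X Y → X ∈ ℒ → Y ∈ ℒ → (X ∘ Y) ∈ ℒ

  StrongElimination : Set
  StrongElimination = ∀ X Y → X ∈ ℒ → Y ∈ ℒ → (e : Fin n) → Sep X Y e →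
    Σ (SignVec n) λ Z → Z ∈ ℒ × lookup Z e ≡ zer ×
      (∀ h → ¬ Sep X Y h → lookup Z h ≡ lookup (X ∘ Y) h)

  Symmetry : Set
  Symmetry = ∀ X → X ∈ ℒ → (- X) ∈ ℒ

  IsOM : Set
  IsOM = Composition × StrongElimination × Symmetry

  Simple : Set
  Simple = (∀ e → Σ (SignVec n) λ X → X ∈ ℒ × lookup X e ≢ zer)
         × (∀ e f → e ≢ f →
              (Σ (SignVec n) λ X → X ∈ ℒ × lookup X e ≢ lookup X f)
            × (Σ (SignVec n) λ X → X ∈ ℒ × lookup X e ≢ negS (lookup X f)))

  -- topes: covectors in {+,-}^U; this is the vertex set of the tope graph
  -- (the induced subgraph of the hypercube on the topes)
  Topes : Pred (PMVec n) 0ℓ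
  Topes v = map ↑ v ∈ ℒ

-- Partial cubes given by their vertex set G ⊆ {+,-}^U (induced subgraph
-- of the hypercube): u ~ v iff they differ in exactly one coordinate.

flipAt : ∀ {n} → Fin n → PMVec n → PMVec n
flipAt e u = updateAt u e flipPM

module _ {n : ℕ} (G : Pred (PMVec n) 0ℓ) where

  Halfspace : Fin n → PM → Pred (PMVec n) 0ℓ
  Halfspace e s v = G v × lookup v e ≡ s

  HalfspaceFamily : Set
  HalfspaceFamily = Fin n → PM → Bool

  ⋂H : HalfspaceFamily → Pred (PMVec n) 0ℓ
  ⋂H F v = G v × (∀ e s → F e s ≡ true → lookup v e ≡ s)

  IsConvex : Pred (PMVec n) 0ℓ → Set
  IsConvex C = (Σ (PMVec n) λ v → C v)
             × (Σ HalfspaceFamily λ F → ∀ v → (C v → ⋂H F v) × (⋂H F v → C v))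

  _∈osc_ : Fin n → Pred (PMVec n) 0ℓ → Set
  e ∈osc C = Σ (PMVec n) λ u → C u × G (flipAt e u) × ¬ C (flipAt e u)

  Shattered : Subset n → Set
  Shattered A = (p : PMVec n) → Σ (PMVec n) λ v → G v × (∀ e → e ∈ₛ A → lookup v e ≡ lookup p e)

  IsVC : ℕ → Set
  IsVC d = (Σ (Subset n) λ A → Shattered A × ∣ A ∣ ≡ d)
         × (∀ A → Shattered A → ∣ A ∣ ≤ d)

  SameSet : Pred (PMVec n) 0ℓ → Pred (PMVec n) 0ℓ → Set
  SameSet C D = ∀ v → (C v → D v) × (D v → C v)

  -- a reconstructible map a : ℋ(G) → X̄(G).  A map on the sets C ∈ ℋ(G) is
  -- given on (C, proof that C ∈ ℋ(G)) and must only depend on the set C.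
  IsReconstructibleMap : ((C : Pred (PMVec n) 0ℓ) → IsConvex C → Subset n) → Set₁
  IsReconstructibleMap a =
      (∀ C c D d → SameSet C D → a C c ≡ a D d)
    × (∀ C c → Shattered (a C c))
    × (∀ C c e → e ∈ₛ a C c → e ∈osc C)
    × (∀ C c → Σ (PMVec n) λ v → ∀ D d → a D d ≡ a C c → D v)

  HasReconstructibleMap : Set₁
  HasReconstructibleMap = Σ ((C : Pred (PMVec n) 0ℓ) → IsConvex C → Subset n) IsReconstructibleMap

_≼_ : ∀ {n} → SignVec n → PMVec n → Set
s ≼ c = ∀ e → lookup s e ≡ zer ⊎ lookup s e ≡ ↑ (lookup c e)

module _ {n : ℕ} (𝒞 : Pred (PMVec n) 0ℓ) where

  Realizable : SignVec n → Set
  Realizable s = Σ (PMVec n) λ c → 𝒞 c × s ≼ c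

  -- proper unlabeled sample compression scheme of size k.
  -- α, β are given as total maps; the requirements are imposed on RS(𝒞)
  -- (resp. on α(RS(𝒞))).
  HasProperUSCS : ℕ → Set
  HasProperUSCS k =
    Σ (SignVec n → Subset n) λ α → Σ (Subset n → PMVec n) λ β →
      ∀ s → Realizable s →
          ∣ α s ∣ ≤ k
        × (∀ e → e ∈ₛ α s → lookup s e ≢ zer)
        × s ≼ β (α s)
        × 𝒞 (β (α s))

{-# OPTIONS --safe #-}
module Submission where

open import Defs
open import Level using (0ℓ)
open import Data.Bool using (true; false)
import Data.Bool.Properties as Bool
open import Data.Fin using (Fin; zero; suc; toℕ; fromℕ<; _<_)
open import Data.Fin.Induction using (<-wellFounded; Acc; acc)
import Data.Fin.Properties as Fin
open import Data.Fin.Subset using (Subset; ⊥; ∣_∣) renaming (_∈_ to _∈ˢ_)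
open import Data.Fin.Subset.Properties using (p⊆q⇒∣p∣≤∣q∣; p⊂q⇒∣p∣<∣q∣; ∣p∣≤n)
open import Data.List using (List; []; _∷_; _++_; filter; allFin)
import Data.List as List
open import Data.List.Membership.Propositional using (_∈_; find; lose)
open import Data.List.Membership.Propositional.Properties using (∈-filter⁺; ∈-filter⁻; ∈-allFin; ∈-++⁺ˡ; ∈-++⁺ʳ; ∈-map⁺)
open import Data.List.Relation.Unary.Any using (Any; here; there)
import Data.List.Relation.Unary.Any as Any
open import Data.Nat as ℕ using (ℕ; zero; suc)
import Data.Nat.Properties as ℕ
open import Data.Product using (Σ; _×_; _,_; proj₁; proj₂)
open import Data.Sum using (_⊎_; inj₁; inj₂)
open import Data.Vec using (Vec; []; _∷_; lookup; map; replicate; tabulate; _[_]≔_)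
open import Data.Vec.Properties using (lookup-zipWith; lookup-map; lookup-replicate; lookup∘update; lookup∘update′; lookup∘updateAt; lookup∘updateAt′; lookup∘tabulate; tabulate-cong; lookup⇒[]=; []=⇒lookup; ≡-dec; map-∘; map-cong; map-id)
open import Function using (case_of_)
open import Relation.Binary.Definitions using (DecidableEquality; tri<; tri≈; tri>)
open import Relation.Binary.PropositionalEquality using (_≡_; _≢_; refl; sym; trans; cong; cong₂; subst; subst₂)
open import Relation.Nullary using (¬_; Dec; yes; no; does; contradiction)
open import Relation.Nullary.Decidable using (_×-dec_; _⊎-dec_; _→-dec_; ¬?; map′; from-yes; dec-true; decidable-stable)
open import Relation.Unary using (Pred)

-- In the realizable case, replace the cone of a sample s by the polyhedron s_i e_i(y) ≥ w_i with
-- w_0 ≫ w_1 ≫ … > 0, bound every coordinate by e_i(y) ≤ M_i with M_0 ≫ M_1 ≫ … ≫ w_0, and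
-- maximise the objective "last coordinate first".  The optimal vertex lies in the open cone of s.
-- Its tight constraints of the first kind form an independent set W ⊆ supp s, and W alone
-- determines the vertex: the tight bounds are a greedy completion of W to a basis, and the signs
-- on W are forced by dual feasibility.  So α(s) = W, and β(W) is the tope of the vertex.
--
-- All of this is combinatorial: the vertex is a composition, by decreasing scale, of the cocircuits
-- dual to the basis.  Optimal bases are unique (eliminate between two of them, as in LP duality),
-- and uniqueness gives existence by deletion and contraction of the last element.
--
-- For the reconstructible map, apply α to the restriction of C to osc(C): because the tope graph
-- is isometric, C consists of all topes that agree with this sample.

-- Signs, and the leading coordinate of a sign vector.

_≟ˢ_ : DecidableEquality Sign
pos ≟ˢ pos = yes refl
pos ≟ˢ neg = no λ ()
pos ≟ˢ zer = no λ ()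
neg ≟ˢ pos = no λ ()
neg ≟ˢ neg = yes refl
neg ≟ˢ zer = no λ ()
zer ≟ˢ pos = no λ ()
zer ≟ˢ neg = no λ ()
zer ≟ˢ zer = yes refl

infix 25 _‼_
_‼_ : ∀ {n} → SignVec n → Fin n → Sign
X ‼ i = lookup X i

∘-‼ : ∀ {n} (X Y : SignVec n) i → (X ∘ Y) ‼ i ≡ X ‼ i ∘ₛ Y ‼ i
∘-‼ X Y i = lookup-zipWith _∘ₛ_ i X Y

neg-‼ : ∀ {n} (X : SignVec n) i → (- X) ‼ i ≡ negS (X ‼ i)
neg-‼ X i = lookup-map i negS X

negS-involutive : ∀ a → negS (negS a) ≡ a
negS-involutive pos = refl
negS-involutive neg = refl
negS-involutive zer = refl

negS-injective : ∀ {a b} → negS a ≡ negS b → a ≡ b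
negS-injective {a} {b} e = trans (sym (negS-involutive a)) (trans (cong negS e) (negS-involutive b))

lookup-ext : ∀ {A : Set} {n} {X Y : Vec A n} → (∀ h → lookup X h ≡ lookup Y h) → X ≡ Y
lookup-ext {X = []} {[]} _ = refl
lookup-ext {X = _ ∷ _} {_ ∷ _} e = cong₂ _∷_ (e zero) (lookup-ext λ h → e (suc h))

∘ₛ-identityʳ : ∀ a → a ∘ₛ zer ≡ a
∘ₛ-identityʳ pos = refl
∘ₛ-identityʳ neg = refl
∘ₛ-identityʳ zer = refl

∘ₛ-zeroˡ : ∀ {a b} → a ≡ zer → a ∘ₛ b ≡ b
∘ₛ-zeroˡ refl = refl

∘ₛ-idem : ∀ a → a ∘ₛ a ≡ a
∘ₛ-idem pos = refl
∘ₛ-idem neg = refl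
∘ₛ-idem zer = refl

∘ₛ-nonzeroˡ : ∀ a b → a ≢ zer → a ∘ₛ b ≡ a
∘ₛ-nonzeroˡ pos b _ = refl
∘ₛ-nonzeroˡ neg b _ = refl
∘ₛ-nonzeroˡ zer b a≢0 = contradiction refl a≢0

∘ₛ-nonzeroʳ : ∀ a b → b ≢ zer → a ∘ₛ b ≢ zer
∘ₛ-nonzeroʳ zer b b≢0 = b≢0
∘ₛ-nonzeroʳ pos b b≢0 ()
∘ₛ-nonzeroʳ neg b b≢0 ()

negS-nonzero : ∀ {a} → a ≢ zer → negS a ≢ zer
negS-nonzero {pos} _ ()
negS-nonzero {neg} _ ()
negS-nonzero {zer} a≢0 = λ _ → a≢0 refl

¬Opp-zerˡ : ∀ {a b} → a ≡ zer → ¬ Opp a b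
¬Opp-zerˡ refl (inj₁ (() , _))
¬Opp-zerˡ refl (inj₂ (() , _))

¬Opp-zerʳ : ∀ {a b} → b ≡ zer → ¬ Opp a b
¬Opp-zerʳ refl (inj₁ (_ , ()))
¬Opp-zerʳ refl (inj₂ (_ , ()))

¬Opp-≡ : ∀ {a b} → a ≡ b → ¬ Opp a b
¬Opp-≡ refl (inj₁ (refl , ()))
¬Opp-≡ refl (inj₂ (refl , ()))

Opp-negS : ∀ {a} → a ≢ zer → Opp a (negS a)
Opp-negS {pos} _ = inj₁ (refl , refl)
Opp-negS {neg} _ = inj₂ (refl , refl)
Opp-negS {zer} a≢0 = contradiction refl a≢0

≢⇒Opp : ∀ {a b} → a ≢ zer → b ≢ zer → a ≢ b → Opp a b
≢⇒Opp {pos} {pos} _ _ a≢b = contradiction refl a≢b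
≢⇒Opp {pos} {neg} _ _ _ = inj₁ (refl , refl)
≢⇒Opp {neg} {pos} _ _ _ = inj₂ (refl , refl)
≢⇒Opp {neg} {neg} _ _ a≢b = contradiction refl a≢b
≢⇒Opp {zer} a≢0 _ _ = contradiction refl a≢0
≢⇒Opp {pos} {zer} _ b≢0 _ = contradiction refl b≢0
≢⇒Opp {neg} {zer} _ b≢0 _ = contradiction refl b≢0

third : ∀ {a b c} → a ≢ zer → b ≢ zer → c ≢ zer → a ≢ b → a ≢ c → b ≡ c
third {a} {b} {c} a≢0 b≢0 c≢0 a≢b a≢c with ≢⇒Opp a≢0 b≢0 a≢b | ≢⇒Opp a≢0 c≢0 a≢c
... | inj₁ (_ , refl) | inj₁ (_ , refl) = refl
... | inj₂ (_ , refl) | inj₂ (_ , refl) = refl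
... | inj₁ (refl , _) | inj₂ (() , _)
... | inj₂ (refl , _) | inj₁ (() , _)

-- The local form of "difference zero implies equal". The premise is what elimination between `X`
-- and `- Y` gives at a coordinate where the result vanishes. For distinct signs `a` and `negS b`
-- are not opposite and their composition is nonzero.
opp-or-same : ∀ a b → (¬ Opp a (negS b) → zer ≡ a ∘ₛ negS b) → a ≡ b
opp-or-same pos pos _ = refl
opp-or-same neg neg _ = refl
opp-or-same zer zer _ = refl
opp-or-same pos neg k with k (λ { (inj₁ (_ , ())) ; (inj₂ (() , _)) })
... | ()
opp-or-same pos zer k with k (λ { (inj₁ (_ , ())) ; (inj₂ (() , _)) })
... | ()
opp-or-same neg pos k with k (λ { (inj₁ (() , _)) ; (inj₂ (_ , ())) })
... | ()
opp-or-same neg zer k with k (λ { (inj₁ (() , _)) ; (inj₂ (_ , ())) })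
... | ()
opp-or-same zer pos k with k (λ { (inj₁ (() , _)) ; (inj₂ (() , _)) })
... | ()
opp-or-same zer neg k with k (λ { (inj₁ (() , _)) ; (inj₂ (() , _)) })
... | ()

-- The objective: the sign of a covector at its last non-zero coordinate.
Lead : ∀ {n} → Sign → SignVec n → Set
Lead {n} σ X = Σ (Fin n) λ i → X ‼ i ≡ σ × (∀ h → i < h → X ‼ h ≡ zer)

lead-cases : ∀ {n} (X : SignVec n) → Lead pos X ⊎ Lead neg X ⊎ (∀ h → X ‼ h ≡ zer)
lead-cases [] = inj₂ (inj₂ λ ())
lead-cases (x ∷ X) with lead-cases X
... | inj₁ (i , p , z) = inj₁ (suc i , p , λ { (suc h) (ℕ.s≤s i<h) → z h i<h })
... | inj₂ (inj₁ (i , p , z)) = inj₂ (inj₁ (suc i , p , λ { (suc h) (ℕ.s≤s i<h) → z h i<h }))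
... | inj₂ (inj₂ z) with x
...   | pos = inj₁ (zero , refl , λ { (suc h) _ → z h })
...   | neg = inj₂ (inj₁ (zero , refl , λ { (suc h) _ → z h }))
...   | zer = inj₂ (inj₂ λ { zero → refl ; (suc h) → z h })

lead-neg : ∀ {n} {σ} (X : SignVec n) → Lead σ X → Lead (negS σ) (- X)
lead-neg X (i , p , z) =
  i , trans (neg-‼ X i) (cong negS p) , λ h i<h → trans (neg-‼ X h) (cong negS (z h i<h))

¬lead-zero : ∀ {n} {σ} (X : SignVec n) → σ ≢ zer → Lead σ X → ¬ (∀ h → X ‼ h ≡ zer)
¬lead-zero X σ≢0 (i , p , _) z = σ≢0 (trans (sym p) (z i))

zeroVec : ∀ {n} → SignVec n
zeroVec {n} = replicate n zer

zeroVec-∘ : ∀ {n} (X Y : SignVec n) → (∀ h → X ‼ h ≡ zer) → X ∘ Y ≡ Y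
zeroVec-∘ [] [] _ = refl
zeroVec-∘ (x ∷ X) (y ∷ Y) z rewrite z zero = cong (y ∷_) (zeroVec-∘ X Y λ h → z (suc h))

-- Compositions of families, ordered by decreasing scale.

compose : ∀ {n m} → (Fin m → SignVec n) → SignVec n → SignVec n
compose {m = zero} g B = B
compose {m = suc m} g B = g zero ∘ compose (λ i → g (suc i)) B

compose-first : ∀ {n m} (g : Fin m → SignVec n) B t h → (∀ t' → t' < t → g t' ‼ h ≡ zer) →
                g t ‼ h ≢ zer → compose g B ‼ h ≡ g t ‼ h
compose-first g B zero h _ nz = trans (∘-‼ (g zero) _ h) (∘ₛ-nonzeroˡ _ _ nz)
compose-first g B (suc t) h z nz = trans (∘-‼ (g zero) _ h) (trans
  (∘ₛ-zeroˡ (z zero (ℕ.s≤s ℕ.z≤n)))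
  (compose-first (λ i → g (suc i)) B t h (λ t' lt → z (suc t') (ℕ.s≤s lt)) nz))

compose-skip : ∀ {n m} (g : Fin m → SignVec n) B h → (∀ t → g t ‼ h ≡ zer) → compose g B ‼ h ≡ B ‼ h
compose-skip {m = zero} g B h z = refl
compose-skip {m = suc m} g B h z = trans (∘-‼ (g zero) _ h) (trans
  (∘ₛ-zeroˡ (z zero)) (compose-skip (λ i → g (suc i)) B h λ t → z (suc t)))

compose-supp : ∀ {n m} (g : Fin m → SignVec n) B h → B ‼ h ≢ zer → compose g B ‼ h ≢ zer
compose-supp {m = zero} g B h nz = nz
compose-supp {m = suc m} g B h nz eq =
  ∘ₛ-nonzeroʳ (g zero ‼ h) _ (compose-supp (λ i → g (suc i)) B h nz) (trans (sym (∘-‼ (g zero) _ h)) eq)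

compose-cong : ∀ {n m} {g g' : Fin m → SignVec n} {B B'} → (∀ t → g t ≡ g' t) → B ≡ B' → compose g B ≡ compose g' B'
compose-cong {m = zero} _ refl = refl
compose-cong {m = suc m} eq eqB = cong₂ _∘_ (eq zero) (compose-cong (λ t → eq (suc t)) eqB)

-- box i is the upper bound e_i(y) ≤ M_i; elem i is the sample constraint s_i e_i(y) ≥ w_i.
-- The order _≺_ is by decreasing scale.
data Slot (n : ℕ) : Set where
  box elem : Fin n → Slot n

el : ∀ {n} → Slot n → Fin n
el (box i) = i
el (elem i) = i

-- The sign of the objective on the cocircuit dual to a tight constraint (dual feasibility).
dir : ∀ {n} → Slot n → Sign
dir (box _) = pos
dir (elem _) = neg

data _≺_ {n} : Slot n → Slot n → Set where
  box<box : ∀ {i j} → i < j → box i ≺ box j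
  box<elem : ∀ {i j} → box i ≺ elem j
  elem<elem : ∀ {i j} → i < j → elem i ≺ elem j

≺-cmp : ∀ {n} (t t' : Slot n) → t ≺ t' ⊎ t ≡ t' ⊎ t' ≺ t
≺-cmp (box i) (box j) with Fin.<-cmp i j
... | tri< lt _ _ = inj₁ (box<box lt)
... | tri≈ _ refl _ = inj₂ (inj₁ refl)
... | tri> _ _ gt = inj₂ (inj₂ (box<box gt))
≺-cmp (box i) (elem j) = inj₁ box<elem
≺-cmp (elem i) (box j) = inj₂ (inj₂ box<elem)
≺-cmp (elem i) (elem j) with Fin.<-cmp i j
... | tri< lt _ _ = inj₁ (elem<elem lt)
... | tri≈ _ refl _ = inj₂ (inj₁ refl)
... | tri> _ _ gt = inj₂ (inj₂ (elem<elem gt))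

≺-irrefl : ∀ {n} {t t' : Slot n} → t ≺ t' → t ≢ t'
≺-irrefl (box<box lt) refl = ℕ.<-irrefl refl lt
≺-irrefl (elem<elem lt) refl = ℕ.<-irrefl refl lt

≺-trans : ∀ {n} {t t' t'' : Slot n} → t ≺ t' → t' ≺ t'' → t ≺ t''
≺-trans (box<box p) (box<box q) = box<box (ℕ.<-trans p q)
≺-trans (box<box p) box<elem = box<elem
≺-trans box<elem (elem<elem q) = box<elem
≺-trans (elem<elem p) (elem<elem q) = elem<elem (ℕ.<-trans p q)

≺-rec : ∀ {n} (P : Slot n → Set) → (∀ t → (∀ t' → t' ≺ t → P t') → P t) → ∀ t → P t
≺-rec {n} P step = λ { (box i) → boxes i (<-wellFounded i) ; (elem i) → elems i (<-wellFounded i) }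
  where
  boxes : ∀ i → Acc _<_ i → P (box i)
  boxes i (acc rs) = step (box i) λ { (box j) (box<box j<i) → boxes j (rs j<i) }
  elems : ∀ i → Acc _<_ i → P (elem i)
  elems i (acc rs) = step (elem i) λ
    { (box j) _ → boxes j (<-wellFounded j)
    ; (elem j) (elem<elem j<i) → elems j (rs j<i) }

_≟ᵗ_ : ∀ {n} → DecidableEquality (Slot n)
t ≟ᵗ t' with ≺-cmp t t'
... | inj₁ lt = no (≺-irrefl lt)
... | inj₂ (inj₁ eq) = yes eq
... | inj₂ (inj₂ gt) = no λ eq → ≺-irrefl gt (sym eq)

slots : ∀ n → List (Slot n)
slots n = List.map box (allFin n) ++ List.map elem (allFin n)

∈-slots : ∀ {n} (t : Slot n) → t ∈ slots n
∈-slots (box i) = ∈-++⁺ˡ (∈-map⁺ box (∈-allFin i))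
∈-slots {n} (elem i) = ∈-++⁺ʳ (List.map box (allFin n)) (∈-map⁺ elem (∈-allFin i))

point : ∀ {n} → (Slot n → SignVec n) → SignVec n → SignVec n
point D B = compose (λ i → D (box i)) (compose (λ i → D (elem i)) B)

point-first : ∀ {n} (D : Slot n → SignVec n) B t h → (∀ t' → t' ≺ t → D t' ‼ h ≡ zer) →
              D t ‼ h ≢ zer → point D B ‼ h ≡ D t ‼ h
point-first D B (box i) h z nz =
  compose-first (λ i → D (box i)) _ i h (λ j lt → z (box j) (box<box lt)) nz
point-first D B (elem i) h z nz = trans
  (compose-skip (λ i → D (box i)) _ h (λ j → z (box j) box<elem))
  (compose-first (λ i → D (elem i)) B i h (λ j lt → z (elem j) (elem<elem lt)) nz)

point-supp : ∀ {n} (D : Slot n → SignVec n) B h → B ‼ h ≢ zer → point D B ‼ h ≢ zer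
point-supp D B h nz = compose-supp (λ i → D (box i)) _ h (compose-supp (λ i → D (elem i)) B h nz)

point-cong : ∀ {n} {D D' : Slot n → SignVec n} B → (∀ t → D t ≡ D' t) → point D B ≡ point D' B
point-cong B eq = compose-cong (λ i → eq (box i)) (compose-cong (λ i → eq (elem i)) refl)

first-nonzero : ∀ {n} (D : Slot n → SignVec n) h → (∀ t → D t ‼ h ≡ zer) ⊎
                Σ (Slot n) λ t → D t ‼ h ≢ zer × (∀ t' → t' ≺ t → D t' ‼ h ≡ zer)
first-nonzero {n} D h = case search (λ i → D (box i)) of λ
  { (inj₂ (i , nz , z)) → inj₂ (box i , nz , λ { (box j) (box<box lt) → z j lt })
  ; (inj₁ zb) → case search (λ i → D (elem i)) of λ
    { (inj₂ (i , nz , z)) → inj₂ (elem i , nz , λ { (box j) _ → zb j ; (elem j) (elem<elem lt) → z j lt })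
    ; (inj₁ ze) → inj₁ λ { (box j) → zb j ; (elem j) → ze j } } }
  where
  search : ∀ {m} (g : Fin m → SignVec n) → (∀ i → g i ‼ h ≡ zer) ⊎
           Σ (Fin m) λ i → g i ‼ h ≢ zer × (∀ j → j < i → g j ‼ h ≡ zer)
  search {zero} g = inj₁ λ ()
  search {suc m} g with g zero ‼ h ≟ˢ zer
  ... | no nz = inj₂ (zero , nz , λ _ ())
  ... | yes z with search (λ i → g (suc i))
  ...   | inj₁ zs = inj₁ λ { zero → z ; (suc i) → zs i }
  ...   | inj₂ (i , nz , zs) = inj₂ (suc i , nz , λ { zero _ → z ; (suc j) (ℕ.s≤s lt) → zs j lt })

-- Elimination and duality for covectors

module Covectors {n : ℕ} (ℒ : List (SignVec n)) (om : IsOM ℒ) where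

  comp : Composition ℒ
  comp = proj₁ om

  se : StrongElimination ℒ
  se = proj₁ (proj₂ om)

  symm : Symmetry ℒ
  symm = proj₂ (proj₂ om)

  -- A combinatorial "X plus a multiple of Y". Positive leads survive because at the last coordinate
  -- where X or Y is nonzero the two signs are not opposite, so the result carries that positive
  -- sign. If `X ‼ j` is already zero, X itself is returned, hence the conditional demand on the
  -- lead of Y.
  elim : ∀ X Y → X ∈ ℒ → Y ∈ ℒ → ∀ j → X ‼ j ≡ zer ⊎ Opp (X ‼ j) (Y ‼ j) →
    Σ (SignVec n) λ Z → Z ∈ ℒ × Z ‼ j ≡ zer × (∀ h → Y ‼ h ≡ zer → Z ‼ h ≡ X ‼ h)
      × (Lead pos X → (X ‼ j ≢ zer → Lead pos Y) → Lead pos Z)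
  elim X Y X∈ Y∈ j (inj₁ z) = X , X∈ , z , (λ _ _ → refl) , λ l _ → l
  elim X Y X∈ Y∈ j (inj₂ op) with se X Y X∈ Y∈ j op
  ... | Z , Z∈ , Zj , off = Z , Z∈ , Zj , fix , λ lX lY → lead lX (lY λ z → ¬Opp-zerˡ z op)
    where
    off' : ∀ h → ¬ Opp (X ‼ h) (Y ‼ h) → Z ‼ h ≡ X ‼ h ∘ₛ Y ‼ h
    off' h ns = trans (off h ns) (∘-‼ X Y h)
    fix : ∀ h → Y ‼ h ≡ zer → Z ‼ h ≡ X ‼ h
    fix h z = trans (off' h (¬Opp-zerʳ z)) (trans (cong (X ‼ h ∘ₛ_) z) (∘ₛ-identityʳ _))
    fixˡ : ∀ h → X ‼ h ≡ zer → Z ‼ h ≡ Y ‼ h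
    fixˡ h z = trans (off' h (¬Opp-zerˡ z)) (cong (_∘ₛ Y ‼ h) z)
    lead : Lead pos X → Lead pos Y → Lead pos Z
    lead (i , p , z) (k , q , w) with Fin.<-cmp i k
    ... | tri< i<k _ _ = k , trans (fixˡ k (z k i<k)) q ,
            λ h k<h → trans (fix h (w h k<h)) (z h (ℕ.<-trans i<k k<h))
    ... | tri≈ _ refl _ = i ,
            trans (off' i (¬Opp-≡ (trans p (sym q)))) (cong₂ _∘ₛ_ p q) ,
            λ h i<h → trans (fix h (w h i<h)) (z h i<h)
    ... | tri> _ _ k<i = i , trans (fix i (w i k<i)) p ,
            λ h i<h → trans (fix h (w h (ℕ.<-trans k<i i<h))) (z h i<h)

  -- Chooses between Y and its negative so that the result can cancel a nonzero sign `a` at `j`.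
  orient : Sign → SignVec n → Fin n → SignVec n
  orient a Y j with Y ‼ j ≟ˢ a
  ... | yes _ = - Y
  ... | no _ = Y

  orient-∈ : ∀ a Y j → Y ∈ ℒ → orient a Y j ∈ ℒ
  orient-∈ a Y j Y∈ with Y ‼ j ≟ˢ a
  ... | yes _ = symm Y Y∈
  ... | no _ = Y∈

  orient-zero : ∀ a Y j h → Y ‼ h ≡ zer → orient a Y j ‼ h ≡ zer
  orient-zero a Y j h z with Y ‼ j ≟ˢ a
  ... | yes _ = trans (neg-‼ Y h) (cong negS z)
  ... | no _ = z

  orient-opp : ∀ a Y j → Y ‼ j ≢ zer → a ≡ zer ⊎ Opp a (orient a Y j ‼ j)
  orient-opp a Y j nz with a ≟ˢ zer
  ... | yes z = inj₁ z
  ... | no a≢0 with Y ‼ j ≟ˢ a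
  ...   | yes refl = inj₂ (subst (Opp _) (sym (neg-‼ Y j)) (Opp-negS nz))
  ...   | no ne = inj₂ (≢⇒Opp a≢0 nz λ eq → ne (sym eq))

  elim± : ∀ X Y → X ∈ ℒ → Y ∈ ℒ → ∀ j → Y ‼ j ≢ zer →
    Σ (SignVec n) λ Z → Z ∈ ℒ × Z ‼ j ≡ zer × (∀ h → Y ‼ h ≡ zer → Z ‼ h ≡ X ‼ h)
  elim± X Y X∈ Y∈ j nz with elim X (orient (X ‼ j) Y j) X∈ (orient-∈ _ Y j Y∈) j (orient-opp _ Y j nz)
  ... | Z , Z∈ , Zj , fix , _ = Z , Z∈ , Zj , λ h z → fix h (orient-zero _ Y j h z)

  -- Gaussian elimination against a dual family. Since `Y t` vanishes at the other active elements,
  -- cleared coordinates stay zero and the remaining ones keep their value in X. This invariant is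
  -- why the sign condition concerns X alone, and why `Y t` is used only where X is nonzero.
  reduce : (Act : Slot n → Set) → (∀ t → Dec (Act t)) → (Y : Slot n → SignVec n) →
    (∀ t → Act t → Y t ∈ ℒ) → (∀ t t' → Act t → Act t' → t' ≢ t → Y t ‼ el t' ≡ zer) →
    ∀ X → X ∈ ℒ → (∀ t → Act t → X ‼ el t ≡ zer ⊎ Opp (X ‼ el t) (Y t ‼ el t)) →
    Σ (SignVec n) λ Z → Z ∈ ℒ × (∀ t → Act t → Z ‼ el t ≡ zer)
      × (∀ h → (∀ t → Act t → Y t ‼ h ≡ zer) → Z ‼ h ≡ X ‼ h)
      × (Lead pos X → (∀ t → Act t → X ‼ el t ≢ zer → Lead pos (Y t)) → Lead pos Z)
  reduce Act Act? Y Y∈ ortho X X∈ opp = case go (slots n) of λ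
    { (Z , Z∈ , zs , _ , fix , lead) → Z , Z∈ , (λ t → zs t (∈-slots t)) , fix , lead }
    where
    go : (L : List (Slot n)) → Σ (SignVec n) λ Z → Z ∈ ℒ
      × (∀ t → t ∈ L → Act t → Z ‼ el t ≡ zer)
      × (∀ t → Act t → Z ‼ el t ≡ zer ⊎ Z ‼ el t ≡ X ‼ el t)
      × (∀ h → (∀ t → Act t → Y t ‼ h ≡ zer) → Z ‼ h ≡ X ‼ h)
      × (Lead pos X → (∀ t → Act t → X ‼ el t ≢ zer → Lead pos (Y t)) → Lead pos Z)
    go [] = X , X∈ , (λ _ ()) , (λ _ _ → inj₂ refl) , (λ _ _ → refl) , λ l _ → l
    go (t ∷ L) with go L | Act? t
    ... | Z , Z∈ , zs , inv , fix , lead | no ¬a =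
      Z , Z∈ , (λ { t' (here refl) a → contradiction a ¬a ; t' (there m) a → zs t' m a }) , inv , fix , lead
    ... | Z , Z∈ , zs , inv , fix , lead | yes a = case elim Z (Y t) Z∈ (Y∈ t a) (el t) Zopp of λ
      { (Z' , Z'∈ , z' , fix' , lead') →
        let keep : ∀ t' → Act t' → t' ≢ t → Z' ‼ el t' ≡ Z ‼ el t'
            keep t' a' ne = fix' (el t') (ortho t t' a a' ne)
        in Z' , Z'∈
        , (λ { t' (here refl) _ → z'
             ; t' (there m) a' → case t' ≟ᵗ t of λ
                 { (yes refl) → z' ; (no ne) → trans (keep t' a' ne) (zs t' m a') } })
        , (λ t' a' → case t' ≟ᵗ t of λ
             { (yes refl) → inj₁ z'
             ; (no ne) → case inv t' a' of λ
                 { (inj₁ e) → inj₁ (trans (keep t' a' ne) e)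
                 ; (inj₂ e) → inj₂ (trans (keep t' a' ne) e) } })
        , (λ h zh → trans (fix' h (zh t a)) (fix h zh))
        , λ lX lY → lead' (lead lX lY) λ nz → lY t a (λ e → case inv t a of λ
             { (inj₁ e') → nz e' ; (inj₂ e') → nz (trans e' e) }) }
      where
      Zopp : Z ‼ el t ≡ zer ⊎ Opp (Z ‼ el t) (Y t ‼ el t)
      Zopp with inv t a
      ... | inj₁ e = inj₁ e
      ... | inj₂ e rewrite e = opp t a

  reduce± : (Act : Slot n → Set) → (∀ t → Dec (Act t)) → (Y : Slot n → SignVec n) →
    (∀ t → Act t → Y t ∈ ℒ) → (∀ t t' → Act t → Act t' → t' ≢ t → Y t ‼ el t' ≡ zer) →
    (∀ t → Act t → Y t ‼ el t ≢ zer) → ∀ X → X ∈ ℒ →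
    Σ (SignVec n) λ Z → Z ∈ ℒ × (∀ t → Act t → Z ‼ el t ≡ zer)
      × (∀ h → (∀ t → Act t → Y t ‼ h ≡ zer) → Z ‼ h ≡ X ‼ h)
  reduce± Act Act? Y Y∈ ortho nz X X∈ =
    let Z , Z∈ , zs , fix , _ = reduce Act Act? (λ t → orient (X ‼ el t) (Y t) (el t))
           (λ t a → orient-∈ _ (Y t) (el t) (Y∈ t a))
           (λ t t' a a' ne → orient-zero _ (Y t) (el t) (el t') (ortho t t' a a' ne))
           X X∈ (λ t a → orient-opp _ (Y t) (el t) (nz t a))
    in Z , Z∈ , zs , λ h zh → fix h λ t a → orient-zero _ (Y t) (el t) h (zh t a)

  compose-∈ : ∀ {m} (g : Fin m → SignVec n) B → (∀ t → g t ∈ ℒ ⊎ (∀ h → g t ‼ h ≡ zer)) →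
              B ∈ ℒ → compose g B ∈ ℒ
  compose-∈ {zero} g B _ B∈ = B∈
  compose-∈ {suc m} g B g∈ B∈ with compose-∈ (λ i → g (suc i)) B (λ t → g∈ (suc t)) B∈ | g∈ zero
  ... | r | inj₁ m∈ = comp _ _ m∈ r
  ... | r | inj₂ z = subst (_∈ ℒ) (sym (zeroVec-∘ _ _ z)) r

  point-∈ : ∀ D B → (∀ t → D t ∈ ℒ ⊎ (∀ h → D t ‼ h ≡ zer)) → B ∈ ℒ → point D B ∈ ℒ
  point-∈ D B D∈ B∈ = compose-∈ _ _ (λ i → D∈ (box i)) (compose-∈ _ _ (λ i → D∈ (elem i)) B∈)

  -- Elimination between X and `- Y`, the counterpart of subtracting vectors that are normalised at
  -- `j`. The last component recovers X and Y being equal from a vanishing difference.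
  difference : ∀ X Y → X ∈ ℒ → Y ∈ ℒ → ∀ j → X ‼ j ≢ zer → X ‼ j ≡ Y ‼ j →
    Σ (SignVec n) λ Z → Z ∈ ℒ × Z ‼ j ≡ zer × (∀ h → Y ‼ h ≡ zer → Z ‼ h ≡ X ‼ h)
      × (∀ h → X ‼ h ≡ zer → Z ‼ h ≡ (- Y) ‼ h) × ((∀ h → Z ‼ h ≡ zer) → ∀ h → X ‼ h ≡ Y ‼ h)
  difference X Y X∈ Y∈ j nz eq with se X (- Y) X∈ (symm Y Y∈) j
      (subst (Opp _) (sym (trans (neg-‼ Y j) (cong negS (sym eq)))) (Opp-negS nz))
  ... | Z , Z∈ , Zj , off = Z , Z∈ , Zj , fixʳ , fixˡ , same
    where
    off' : ∀ h → ¬ Opp (X ‼ h) (negS (Y ‼ h)) → Z ‼ h ≡ X ‼ h ∘ₛ negS (Y ‼ h)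
    off' h ns = trans (off h (λ op → ns (subst (Opp _) (neg-‼ Y h) op)))
      (trans (∘-‼ X (- Y) h) (cong (X ‼ h ∘ₛ_) (neg-‼ Y h)))
    fixʳ : ∀ h → Y ‼ h ≡ zer → Z ‼ h ≡ X ‼ h
    fixʳ h z = trans (off' h (¬Opp-zerʳ (cong negS z)))
      (trans (cong (λ a → X ‼ h ∘ₛ negS a) z) (∘ₛ-identityʳ _))
    fixˡ : ∀ h → X ‼ h ≡ zer → Z ‼ h ≡ (- Y) ‼ h
    fixˡ h z = trans (off' h (¬Opp-zerˡ z)) (trans (∘ₛ-zeroˡ z) (sym (neg-‼ Y h)))
    same : (∀ h → Z ‼ h ≡ zer) → ∀ h → X ‼ h ≡ Y ‼ h
    same z h = opp-or-same _ _ λ ns → trans (sym (z h)) (off' h ns)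

  -- Greedy bases and their dual cocircuits.

  Vanishes : Subset n → SignVec n → Set
  Vanishes W X = ∀ j → lookup W j ≡ true → X ‼ j ≡ zer

  Pivot : Subset n → Fin n → SignVec n → Set
  Pivot W i X = Vanishes W X × (∀ h → i < h → X ‼ h ≡ zer) × X ‼ i ≢ zer

  -- The greedy completion of W to a basis, starting from the last index.
  Box : Subset n → Fin n → Set
  Box W i = Σ (SignVec n) λ X → X ∈ ℒ × Pivot W i X

  Box? : ∀ W i → Dec (Box W i)
  Box? W i = map′ find (λ { (_ , X∈ , p) → lose X∈ p }) (Any.any? pivot? ℒ)
    where
    pivot? : ∀ X → Dec (Pivot W i X)
    pivot? X = Fin.all? (λ j → (lookup W j Bool.≟ true) →-dec (X ‼ j ≟ˢ zer))
      ×-dec Fin.all? (λ h → (i Fin.<? h) →-dec (X ‼ h ≟ˢ zer))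
      ×-dec ¬? (X ‼ i ≟ˢ zer)

  Active : Subset n → Slot n → Set
  Active W (box i) = Box W i
  Active W (elem i) = lookup W i ≡ true

  Active? : ∀ W t → Dec (Active W t)
  Active? W (box i) = Box? W i
  Active? W (elem i) = lookup W i Bool.≟ true

  -- The last nonzero index of X would be a greedy element, with X itself as the witness, so X would
  -- have to vanish there.
  spanning : ∀ W X → X ∈ ℒ → (∀ t → Active W t → X ‼ el t ≡ zer) → ∀ h → X ‼ h ≡ zer
  spanning W X X∈ z = case lead-cases X of λ
    { (inj₁ l) → contradiction l (no-lead λ ())
    ; (inj₂ (inj₁ l)) → contradiction l (no-lead λ ())
    ; (inj₂ (inj₂ zeros)) → zeros }
    where
    no-lead : ∀ {σ} → σ ≢ zer → ¬ Lead σ X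
    no-lead σ≢0 (i , p , above) =
      nz (z (box i) (X , X∈ , (λ j → z (elem j)) , above , nz))
      where
      nz : X ‼ i ≢ zer
      nz e = σ≢0 (trans (sym p) e)

  -- The fundamental cocircuit of `t` with respect to the basis of active slots. It is normalised by
  -- the sign of the objective, not by its sign at `el t`.
  record Dual (W : Subset n) (t : Slot n) (X : SignVec n) : Set where
    field
      member : X ∈ ℒ
      ortho : ∀ t' → Active W t' → t' ≢ t → X ‼ el t' ≡ zer
      nonzero : X ‼ el t ≢ zer
      lead : Lead (dir t) X
  open Dual

  -- The last nonzero index of X is a greedy element, because X witnesses it. Orthogonality leaves
  -- only `i` for this index.
  dual-above : ∀ {W i X} → Dual W (box i) X → ∀ h → i < h → X ‼ h ≡ zer
  dual-above {W} {i} {X} d h i<h with lead d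
  ... | k , p , above with k Fin.≟ i
  ...   | yes refl = above h i<h
  ...   | no k≢i = contradiction
          (trans (sym p) (ortho d (box k)
            (X , member d , (λ j a → ortho d (elem j) a λ ()) , above , λ e → case trans (sym p) e of λ ())
            λ { refl → k≢i refl })) λ ()

  dual-box-pos : ∀ {W i X} → Dual W (box i) X → X ‼ i ≡ pos
  dual-box-pos {W} {i} {X} d with lead d
  ... | k , p , above with Fin.<-cmp k i
  ...   | tri< k<i _ _ = contradiction (above i k<i) (nonzero d)
  ...   | tri≈ _ refl _ = p
  ...   | tri> _ _ i<k = contradiction (trans (sym p) (dual-above d k i<k)) λ ()

  -- If the signs at `el t` agree, the difference vanishes on the basis, hence everywhere. They
  -- always agree for a box. For an `elem` with opposite signs, eliminating between the negatives
  -- would give a covector that vanishes on the basis but has a positive lead.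
  dual-unique : ∀ {W t X Y} → Dual W t X → Dual W t Y → X ≡ Y
  dual-unique {W} {t} {X} {Y} dX dY with X ‼ el t ≟ˢ Y ‼ el t
  ... | yes eq =
    let Z , Z∈ , Zt , _ , fixˡ , same = difference X Y (member dX) (member dY) (el t) (nonzero dX) eq
    in lookup-ext (same (spanning W Z Z∈ λ t' a → case t' ≟ᵗ t of λ
         { (yes refl) → Zt
         ; (no ne) → trans (fixˡ (el t') (ortho dX t' a ne)) (trans (neg-‼ Y _) (cong negS (ortho dY t' a ne))) }))
  ... | no ne with t
  ...   | box i = contradiction (trans (dual-box-pos dX) (sym (dual-box-pos dY))) ne
  ...   | elem i =
    let Z , Z∈ , Zt , fix , lead' = elim (- X) (- Y) (symm X (member dX)) (symm Y (member dY)) i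
          (inj₂ (subst₂ Opp (sym (neg-‼ X i)) (sym (neg-‼ Y i))
            (≢⇒Opp (negS-nonzero (nonzero dX)) (negS-nonzero (nonzero dY)) λ e → ne (negS-injective e))))
        vanish : ∀ {V} → Dual W (elem i) V → ∀ t' → Active W t' → t' ≢ elem i → (- V) ‼ el t' ≡ zer
        vanish {V} d t' a t'≢ = trans (neg-‼ V _) (cong negS (ortho d t' a t'≢))
    in contradiction
         (spanning W Z Z∈ λ t' a → case t' ≟ᵗ elem i of λ
           { (yes refl) → Zt
           ; (no t'≢) → trans (fix (el t') (vanish dY t' a t'≢)) (vanish dX t' a t'≢) })
         (¬lead-zero Z (λ ()) (lead' (lead-neg X (lead dX)) λ _ → lead-neg Y (lead dY)))

  record Frame (W : Subset n) (D : Slot n → SignVec n) : Set where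
    field
      inactive : ∀ t → ¬ Active W t → ∀ h → D t ‼ h ≡ zer
      dual : ∀ t → Active W t → Dual W t (D t)
  open Frame

  frame-∈ : ∀ {W D} → Frame W D → ∀ t → D t ∈ ℒ ⊎ (∀ h → D t ‼ h ≡ zer)
  frame-∈ {W} F t with Active? W t
  ... | yes a = inj₁ (member (dual F t a))
  ... | no ¬a = inj₂ (inactive F t ¬a)


  -- No direction that keeps all tight constraints feasible improves the objective.
  certificate : ∀ {W D Z} → Frame W D → Z ∈ ℒ → (∀ l → Box W l → Z ‼ l ≡ zer) →
    (∀ j → lookup W j ≡ true → Z ‼ j ≡ zer ⊎ Z ‼ j ≡ D (elem j) ‼ j) → ¬ Lead pos Z
  certificate {W} {D} {Z} F Z∈ zb ze lZ =
    let Z' , Z'∈ , z' , _ , lead' = reduce (Active W) (Active? W) (λ t → - D t)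
          (λ t a → symm _ (member (dual F t a)))
          (λ t t' a a' ne → trans (neg-‼ (D t) _) (cong negS (ortho (dual F t a) t' a' ne)))
          Z Z∈ opp
    in ¬lead-zero Z' (λ ()) (lead' lZ leads) (spanning W Z' Z'∈ z')
    where
    opp : ∀ t → Active W t → Z ‼ el t ≡ zer ⊎ Opp (Z ‼ el t) ((- D t) ‼ el t)
    opp (box l) a = inj₁ (zb l a)
    opp (elem j) a with ze j a
    ... | inj₁ z = inj₁ z
    ... | inj₂ e = inj₂ (subst₂ Opp (sym e) (sym (neg-‼ (D (elem j)) j)) (Opp-negS (nonzero (dual F (elem j) a))))
    leads : ∀ t → Active W t → Z ‼ el t ≢ zer → Lead pos (- D t)
    leads (box l) a nz = contradiction (zb l a) nz
    leads (elem j) a nz = lead-neg (D (elem j)) (lead (dual F (elem j) a))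

  -- The value of e_i at the vertex has sign σ and dominates the scale w_i; agreement in sign
  -- alone would not make solutions unique.
  FirstAt : (Slot n → SignVec n) → Fin n → Sign → Set
  FirstAt D i σ = Σ (Slot n) λ t → t ≺ elem i × D t ‼ i ≡ σ × (∀ t' → t' ≺ t → D t' ‼ i ≡ zer)

  record Solution (s : Fin n → Sign) (W : Subset n) (D : Slot n → SignVec n) : Set where
    field
      frame : Frame W D
      tight : ∀ i → lookup W i ≡ true → D (elem i) ‼ i ≡ s i
      covered : ∀ i → lookup W i ≢ true → s i ≢ zer → FirstAt D i (s i)
  open Solution

  solution-support : ∀ {s W D} → Solution s W D → ∀ i → lookup W i ≡ true → s i ≢ zer
  solution-support S i a z = nonzero (dual (frame S) (elem i) a) (trans (tight S i a) z)

  -- Uniqueness of the optimal basis.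

  Agree : (W W' : Subset n) (D D' : Slot n → SignVec n) → Slot n → Set
  Agree W W' D D' t = (Active W t → Active W' t) × (Active W' t → Active W t) × (∀ h → D t ‼ h ≡ D' t ‼ h)

  agree-sym : ∀ {W W' D D' t} → Agree W W' D D' t → Agree W' W D' D t
  agree-sym (f , g , e) = g , f , λ h → sym (e h)

  -- Compare `t` with the first scale `t₁` at which the first solution is nonzero at `j`. If `t₁` is
  -- `t`, the sign is `s j`; if it comes later, the sign is zero. It cannot come earlier, since
  -- there the two families coincide and the second one vanishes at its tight element `j`.
  signs-elem : ∀ {s W W' D D'} → Solution s W D → Solution s W' D' → ∀ t → Active W t →
    (∀ t' → t' ≺ t → Agree W W' D D' t') →
    ∀ j → lookup W' j ≡ true → elem j ≢ t → D t ‼ j ≡ zer ⊎ D t ‼ j ≡ s j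
  signs-elem {s} {W} {W'} {D} {D'} S S' t a ih j a' ne with lookup W j Bool.≟ true
  ... | yes aj = inj₁ (ortho (dual (frame S) t a) (elem j) aj ne)
  ... | no ¬aj with covered S j ¬aj (solution-support S' j a')
  ...   | t₁ , t₁≺ , e , z with ≺-cmp t₁ t
  ...     | inj₂ (inj₁ refl) = inj₂ e
  ...     | inj₂ (inj₂ t≺t₁) = inj₁ (z t t≺t₁)
  ...     | inj₁ t₁≺t = contradiction (trans (sym e) zero₁) (solution-support S' j a')
    where
    zero₁ : D t₁ ‼ j ≡ zer
    zero₁ with Active? W t₁
    ... | no ¬a₁ = inactive (frame S) t₁ ¬a₁ j
    ... | yes a₁ = trans (proj₂ (proj₂ (ih t₁ t₁≺t)) j)
            (ortho (dual (frame S') t₁ (proj₁ (ih t₁ t₁≺t) a₁)) (elem j) a' λ eq → ≺-irrefl t₁≺ (sym eq))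

  -- Boxes before `t` are active in both solutions, so orthogonality applies. Boxes beyond a box `t`
  -- lie above the leading index of its dual.
  signs-box : ∀ {s W W' D D'} → Solution s W D → Solution s W' D' → ∀ t → Active W t →
    (∀ t' → t' ≺ t → Agree W W' D D' t') → ∀ l → Box W' l → box l ≢ t → D t ‼ l ≡ zer
  signs-box S S' (elem i) a ih l al ne =
    ortho (dual (frame S) (elem i) a) (box l) (proj₁ (proj₂ (ih (box l) box<elem)) al) ne
  signs-box S S' (box i) a ih l al ne with Fin.<-cmp l i
  ... | tri< l<i _ _ = ortho (dual (frame S) (box i) a) (box l) (proj₁ (proj₂ (ih (box l) (box<box l<i))) al) ne
  ... | tri≈ _ refl _ = contradiction refl ne
  ... | tri> _ _ i<l = dual-above (dual (frame S) (box i) a) l i<l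

  -- An `elem` tight only in the first solution would be covered in the second by an earlier vector,
  -- but the same vector of the first solution vanishes there. A box active only in the first
  -- solution has a dual that would improve the objective at the second, against `certificate`.
  active-agree : ∀ {s W W' D D'} → Solution s W D → Solution s W' D' → ∀ t →
    (∀ t' → t' ≺ t → Agree W W' D D' t') → Active W t → Active W' t
  active-agree {s} {W} {W'} {D} {D'} S S' t ih a with Active? W' t
  ... | yes a' = a'
  ... | no ¬a' = contradiction a (impossible t ih ¬a')
    where
    impossible : ∀ t → (∀ t' → t' ≺ t → Agree W W' D D' t') → ¬ Active W' t → ¬ Active W t
    impossible (elem i) ih ¬a' a with covered S' i ¬a' (solution-support S i a)
    ... | t₁ , t₁≺ , e , _ with Active? W' t₁
    ...   | no ¬a₁ = solution-support S i a (trans (sym e) (inactive (frame S') t₁ ¬a₁ i))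
    ...   | yes a₁ = let f , g , eq = ih t₁ t₁≺ in solution-support S i a
              (trans (sym e) (trans (sym (eq i)) (ortho (dual (frame S) t₁ (g a₁)) (elem i) a λ eq' → ≺-irrefl t₁≺ (sym eq'))))
    impossible (box i) ih ¬a' a = certificate (frame S') (member (dual (frame S) (box i) a))
      (λ l al → signs-box S S' (box i) a ih l al λ { refl → ¬a' al })
      (λ j aj → case signs-elem S S' (box i) a ih j aj (λ ()) of λ
         { (inj₁ z) → inj₁ z ; (inj₂ e) → inj₂ (trans e (sym (tight S' j aj))) })
      (lead (dual (frame S) (box i) a))

  -- Induction along the scales. The difference of the two duals at `t` is a feasible direction for
  -- the second solution and its negative is one for the first. Neither may have a positive lead, so
  -- the difference is zero.
  solution-agree : ∀ {s W W' D D'} → Solution s W D → Solution s W' D' → ∀ t → Agree W W' D D' t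
  solution-agree {s} {W} {W'} {D} {D'} S S' = ≺-rec _ step
    where
    at-el : ∀ t → Active W t → Active W' t → D t ‼ el t ≡ D' t ‼ el t
    at-el (box i) a a' = trans (dual-box-pos (dual (frame S) (box i) a)) (sym (dual-box-pos (dual (frame S') (box i) a')))
    at-el (elem i) a a' = trans (tight S i a) (sym (tight S' i a'))
    dual-agree : ∀ t → (∀ t' → t' ≺ t → Agree W W' D D' t') → Active W t → Active W' t → ∀ h → D t ‼ h ≡ D' t ‼ h
    dual-agree t ih a a' =
      let d = dual (frame S) t a
          d' = dual (frame S') t a'
          ih' = λ t' lt → agree-sym {W} {W'} {D} {D'} {t'} (ih t' lt)
          Z , Z∈ , Zt , fixʳ , fixˡ , same = difference (D t) (D' t) (member d) (member d') (el t) (nonzero d) (at-el t a a')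
          ¬pos = certificate (frame S') Z∈
            (λ l al → case box l ≟ᵗ t of λ
               { (yes refl) → Zt
               ; (no ne) → trans (fixʳ l (ortho d' (box l) al ne)) (signs-box S S' t a ih l al ne) })
            (λ j aj → case elem j ≟ᵗ t of λ
               { (yes refl) → inj₁ Zt
               ; (no ne) → let e = fixʳ j (ortho d' (elem j) aj ne) in case signs-elem S S' t a ih j aj ne of λ
                  { (inj₁ z) → inj₁ (trans e z)
                  ; (inj₂ z) → inj₂ (trans e (trans z (sym (tight S' j aj)))) } })
          negate : ∀ {h} → Z ‼ h ≡ (- D' t) ‼ h → (- Z) ‼ h ≡ D' t ‼ h
          negate {h} e = trans (neg-‼ Z h) (trans (cong negS (trans e (neg-‼ (D' t) h))) (negS-involutive _))
          ¬neg = certificate (frame S) (symm Z Z∈)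
            (λ l al → case box l ≟ᵗ t of λ
               { (yes refl) → trans (neg-‼ Z l) (cong negS Zt)
               ; (no ne) → trans (negate (fixˡ l (ortho d (box l) al ne))) (signs-box S' S t a' ih' l al ne) })
            (λ j aj → case elem j ≟ᵗ t of λ
               { (yes refl) → inj₁ (trans (neg-‼ Z j) (cong negS Zt))
               ; (no ne) → let e = negate (fixˡ j (ortho d (elem j) aj ne)) in case signs-elem S' S t a' ih' j aj ne of λ
                  { (inj₁ z) → inj₁ (trans e z)
                  ; (inj₂ z) → inj₂ (trans e (trans z (sym (tight S j aj)))) } })
      in same (case lead-cases Z of λ
           { (inj₁ l) → contradiction l ¬pos
           ; (inj₂ (inj₁ l)) → contradiction (lead-neg Z l) ¬neg
           ; (inj₂ (inj₂ z)) → z })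
    step : ∀ t → (∀ t' → t' ≺ t → Agree W W' D D' t') → Agree W W' D D' t
    step t ih = fwd , bwd , eq
      where
      fwd = active-agree S S' t ih
      bwd = active-agree S' S t (λ t' lt → agree-sym {W} {W'} {D} {D'} {t'} (ih t' lt))
      eq : ∀ h → D t ‼ h ≡ D' t ‼ h
      eq with Active? W t
      ... | yes a = dual-agree t ih a (fwd a)
      ... | no ¬a = λ h → trans (inactive (frame S) t ¬a h) (sym (inactive (frame S') t (λ a' → ¬a (bwd a')) h))

  -- Reduced echelon form and the empty sample.

  -- The other greedy coordinates are cleared from the highest index downwards. Those above `i`
  -- vanish already. A pivot vector for `k` below `i` is zero beyond `k`, so it disturbs neither the
  -- cleared coordinates nor the entry at `i`.
  echelon : ∀ W i → Box W i → Σ (SignVec n) λ Z → Z ∈ ℒ × Pivot W i Z × (∀ l → Box W l → l ≢ i → Z ‼ l ≡ zer)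
  echelon W i (X , X∈ , pX) =
    let Z , Z∈ , pZ , zs = down n ℕ.≤-refl (X , X∈ , pX , λ l n≤l → contradiction (Fin.toℕ<n l) (ℕ.≤⇒≯ n≤l))
    in Z , Z∈ , pZ , λ l → zs l ℕ.z≤n
    where
    Cleared : ℕ → Set
    Cleared m = Σ (SignVec n) λ Z → Z ∈ ℒ × Pivot W i Z × (∀ l → m ℕ.≤ toℕ l → Box W l → l ≢ i → Z ‼ l ≡ zer)
    step : ∀ m → m ℕ.< n → Cleared (suc m) → Cleared m
    step m m<n (Z , Z∈ , pZ@(van , above , nz) , zs) = case Fin.<-cmp k i of λ
      { (tri≈ _ k≡i _) → Z , Z∈ , pZ , extend Z (λ _ ne → contradiction k≡i ne) zs
      ; (tri> _ _ i<k) → Z , Z∈ , pZ , extend Z (λ _ _ → above k i<k) zs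
      ; (tri< k<i _ _) → case Box? W k of λ
        { (no ¬b) → Z , Z∈ , pZ , extend Z (λ b → contradiction b ¬b) zs
        ; (yes (Y , Y∈ , vanY , aboveY , nzY)) →
            let Z' , Z'∈ , Zk , fix = elim± Z Y Z∈ Y∈ k nzY
            in Z' , Z'∈
             , ( (λ j a → trans (fix j (vanY j a)) (van j a))
               , (λ h i<h → trans (fix h (aboveY h (ℕ.<-trans k<i i<h))) (above h i<h))
               , (λ e → nz (trans (sym (fix i (aboveY i k<i))) e)))
             , extend Z' (λ _ _ → Zk) (λ l m<l b ne →
                 trans (fix l (aboveY l (subst (ℕ._< toℕ l) (sym (Fin.toℕ-fromℕ< m<n)) m<l))) (zs l m<l b ne)) } }
      where
      k : Fin n
      k = fromℕ< m<n
      extend : ∀ Z → (Box W k → k ≢ i → Z ‼ k ≡ zer) → (∀ l → suc m ℕ.≤ toℕ l → Box W l → l ≢ i → Z ‼ l ≡ zer) →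
               ∀ l → m ℕ.≤ toℕ l → Box W l → l ≢ i → Z ‼ l ≡ zer
      extend Z zk zs l m≤l b ne with m ℕ.≟ toℕ l
      ... | no m≢l = zs l (ℕ.≤∧≢⇒< m≤l m≢l) b ne
      ... | yes refl with Fin.fromℕ<-toℕ l m<n
      ...   | eq = subst (λ j → Z ‼ j ≡ zer) eq (zk (subst (Box W) (sym eq) b) λ e → ne (trans (sym eq) e))
    down : ∀ m → m ℕ.≤ n → Cleared m → Cleared 0
    down zero _ c = c
    down (suc m) m<n c = down m (ℕ.<⇒≤ m<n) (step m m<n c)

  ⊥-inactive : ∀ i → ¬ Active ⊥ (elem i)
  ⊥-inactive i a = contradiction (trans (sym (lookup-replicate i false)) a) λ ()

  box-dual : ∀ i → Box ⊥ i → Σ (SignVec n) (Dual ⊥ (box i))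
  box-dual i b with echelon ⊥ i b
  ... | Z , Z∈ , (_ , above , nz) , zs with Z ‼ i in eq
  ...   | zer = contradiction refl nz
  ...   | pos = Z , record
          { member = Z∈
          ; ortho = λ { (box l) bl ne → zs l bl (λ { refl → ne refl })
                      ; (elem j) a _ → contradiction a (⊥-inactive j) }
          ; nonzero = λ e → case trans (sym eq) e of λ ()
          ; lead = i , eq , above }
  ...   | neg = - Z , record
          { member = symm Z Z∈
          ; ortho = λ { (box l) bl ne → trans (neg-‼ Z l) (cong negS (zs l bl (λ { refl → ne refl })))
                      ; (elem j) a _ → contradiction a (⊥-inactive j) }
          ; nonzero = λ e → case trans (sym (trans (neg-‼ Z i) (cong negS eq))) e of λ ()
          ; lead = lead-neg Z (i , eq , above) }

  ⊥-solution : ∀ s → (∀ i → s i ≡ zer) → Σ (Slot n → SignVec n) (Solution s ⊥)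
  ⊥-solution s z = D , record
    { frame = record { inactive = λ t ¬a → inactiveD t ¬a ; dual = dualD }
    ; tight = λ i a → contradiction a (⊥-inactive i)
    ; covered = λ i _ nz → contradiction (z i) nz }
    where
    D : Slot n → SignVec n
    D (elem i) = zeroVec
    D (box i) with Box? ⊥ i
    ... | yes b = proj₁ (box-dual i b)
    ... | no _ = zeroVec
    inactiveD : ∀ t → ¬ Active ⊥ t → ∀ h → D t ‼ h ≡ zer
    inactiveD (elem i) _ h = lookup-replicate h zer
    inactiveD (box i) ¬a h with Box? ⊥ i
    ... | yes b = contradiction b ¬a
    ... | no _ = lookup-replicate h zer
    dualD : ∀ t → Active ⊥ t → Dual ⊥ t (D t)
    dualD (elem i) a = contradiction a (⊥-inactive i)
    dualD (box i) a with Box? ⊥ i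
    ... | yes b = proj₂ (box-dual i b)
    ... | no ¬b = contradiction a ¬b

  -- The vertex of a solution.

  solution-cong : ∀ {s s' W D} → (∀ i → s i ≡ s' i) → Solution s W D → Solution s' W D
  solution-cong {s} {s'} eq S = record
    { frame = frame S
    ; tight = λ i a → trans (tight S i a) (eq i)
    ; covered = λ i ¬a nz → let t , lt , v , z = covered S i ¬a (λ e → nz (trans (sym (eq i)) e))
                            in t , lt , trans v (eq i) , z }

  -- For `i` outside W the first nonzero scale has the right sign by `covered`. For `i` in W all
  -- earlier duals are orthogonal to `i`, so `elem i` is the first nonzero scale there.
  solution-point : ∀ {s W D} → Solution s W D → ∀ B i → s i ≢ zer → point D B ‼ i ≡ s i
  solution-point {s} {W} {D} S B i nz with lookup W i Bool.≟ true
  ... | no ¬a = let t , _ , e , z = covered S i ¬a nz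
                in trans (point-first D B t i z λ e' → nz (trans (sym e) e')) e
  ... | yes a = trans (point-first D B (elem i) i zeros λ e' → nz (trans (sym (tight S i a)) e')) (tight S i a)
    where
    zeros : ∀ t' → t' ≺ elem i → D t' ‼ i ≡ zer
    zeros t' lt with Active? W t'
    ... | yes a' = ortho (dual (frame S) t' a') (elem i) a λ eq → ≺-irrefl lt (sym eq)
    ... | no ¬a' = inactive (frame S) t' ¬a' i

  -- If all duals vanished at `e`, reducing X by them would keep its nonzero entry at `e`, yet the
  -- reduced covector is zero by `spanning`.
  frame-spans : ∀ {W D} → Frame W D → ∀ e X → X ∈ ℒ → X ‼ e ≢ zer → ¬ (∀ t → D t ‼ e ≡ zer)
  frame-spans {W} {D} F e X X∈ nz z =
    let Z , Z∈ , zs , fix = reduce± (Active W) (Active? W) D (λ t a → member (dual F t a))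
          (λ t t' a a' ne → ortho (dual F t a) t' a' ne) (λ t a → nonzero (dual F t a)) X X∈
    in nz (trans (sym (fix e λ t _ → z t)) (spanning W Z Z∈ zs e))

-- Contraction and existence of solutions

_[_↦_] : ∀ {n} → (Fin n → Sign) → Fin n → Sign → Fin n → Sign
(s [ e ↦ σ ]) i with i Fin.≟ e
... | yes _ = σ
... | no _ = s i

update-same : ∀ {n} (s : Fin n → Sign) e σ → (s [ e ↦ σ ]) e ≡ σ
update-same s e σ with e Fin.≟ e
... | yes _ = refl
... | no ne = contradiction refl ne

update-other : ∀ {n} (s : Fin n → Sign) e σ i → i ≢ e → (s [ e ↦ σ ]) i ≡ s i
update-other s e σ i ne with i Fin.≟ e
... | yes eq = contradiction eq ne
... | no _ = refl

-- Contraction on the same ground set: `e` remains as a loop, so slots and subsets keep their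
-- indices.
_/_ : ∀ {n} → List (SignVec n) → Fin n → List (SignVec n)
ℒ / e = filter (λ X → X ‼ e ≟ˢ zer) ℒ

contraction-isOM : ∀ {n} (ℒ : List (SignVec n)) e → IsOM ℒ → IsOM (ℒ / e)
contraction-isOM ℒ e (comp , se , symm) = comp' , se' , symm'
  where
  at : ∀ X → Dec (X ‼ e ≡ zer)
  at X = X ‼ e ≟ˢ zer
  comp-at : ∀ X Y → X ‼ e ≡ zer → Y ‼ e ≡ zer → (X ∘ Y) ‼ e ≡ zer
  comp-at X Y x y = trans (∘-‼ X Y e) (cong₂ _∘ₛ_ x y)
  comp' : Composition (ℒ / e)
  comp' X Y X∈ Y∈ =
    let X∈ℒ , x = ∈-filter⁻ at X∈
        Y∈ℒ , y = ∈-filter⁻ at Y∈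
    in ∈-filter⁺ at (comp X Y X∈ℒ Y∈ℒ) (comp-at X Y x y)
  se' : StrongElimination (ℒ / e)
  se' X Y X∈ Y∈ f sep =
    let X∈ℒ , x = ∈-filter⁻ at X∈
        Y∈ℒ , y = ∈-filter⁻ at Y∈
        Z , Z∈ , Zf , off = se X Y X∈ℒ Y∈ℒ f sep
    in Z , ∈-filter⁺ at Z∈ (trans (off e (¬Opp-zerˡ x)) (comp-at X Y x y)) , Zf , off
  symm' : Symmetry (ℒ / e)
  symm' X X∈ =
    let X∈ℒ , x = ∈-filter⁻ at X∈
    in ∈-filter⁺ at (symm X X∈ℒ) (trans (neg-‼ X e) (cong negS x))

module Contraction {n : ℕ} (ℒ : List (SignVec n)) (om : IsOM ℒ) (e : Fin n) where
  open Covectors ℒ om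
  open Covectors.Dual
  open Covectors.Frame
  open Covectors.Solution

  om/e : IsOM (ℒ / e)
  om/e = contraction-isOM ℒ e om

  module C/ = Covectors (ℒ / e) om/e

  /⇒∈ : ∀ {X} → X ∈ ℒ / e → X ∈ ℒ
  /⇒∈ X∈ = proj₁ (∈-filter⁻ (λ X → X ‼ e ≟ˢ zer) X∈)

  /⇒zero : ∀ {X} → X ∈ ℒ / e → X ‼ e ≡ zer
  /⇒zero {X} X∈ = proj₂ (∈-filter⁻ (λ X → X ‼ e ≟ˢ zer) {xs = ℒ} X∈)

  ∈⇒/ : ∀ {X} → X ∈ ℒ → X ‼ e ≡ zer → X ∈ ℒ / e
  ∈⇒/ = ∈-filter⁺ (λ X → X ‼ e ≟ˢ zer)

  module _ (W : Subset n) where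

    W⁺ : Subset n
    W⁺ = W [ e ]≔ true

    W⁺-e : lookup W⁺ e ≡ true
    W⁺-e = lookup∘update e W true

    W⊆W⁺ : ∀ j → lookup W j ≡ true → lookup W⁺ j ≡ true
    W⊆W⁺ j a with j Fin.≟ e
    ... | yes refl = W⁺-e
    ... | no ne = trans (lookup∘update′ ne W true) a

    W⁺⊆W : ∀ j → j ≢ e → lookup W⁺ j ≡ true → lookup W j ≡ true
    W⁺⊆W j ne a = trans (sym (lookup∘update′ ne W true)) a

    /⇒active : ∀ t → C/.Active W t → Active W⁺ t
    /⇒active (elem i) a = W⊆W⁺ i a
    /⇒active (box i) (X , X∈ , van , rest) = X , /⇒∈ X∈ , van⁺ , rest
      where
      van⁺ : Vanishes W⁺ X
      van⁺ j a with j Fin.≟ e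
      ... | yes refl = /⇒zero X∈
      ... | no ne = van j (W⁺⊆W j ne a)

    active⇒/ : ∀ t → t ≢ elem e → Active W⁺ t → C/.Active W t
    active⇒/ (elem i) ne a = W⁺⊆W i (λ { refl → ne refl }) a
    active⇒/ (box i) ne (X , X∈ , van , rest) =
      X , ∈⇒/ X∈ (van e W⁺-e) , (λ j a → van j (W⊆W⁺ j a)) , rest

    module _ {D : Slot n → SignVec n} (F : C/.Frame W D) (X : SignVec n) (X∈ : X ∈ ℒ) (X≢0 : X ‼ e ≢ zer) where

      -- The one dual missing from the frame of the contraction. Reducing X by that frame does not
      -- change its entry at `e`, as all vectors of the frame vanish there. The sign of the result
      -- is fixed by the required negative lead.
      new-dual : Σ (SignVec n) (Dual W⁺ (elem e))
      new-dual =
        let Z , Z∈ , zs , fix = reduce± (C/.Active W) (C/.Active? W) D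
              (λ t a → /⇒∈ (member (dual F t a)))
              (λ t t' a a' ne → ortho (dual F t a) t' a' ne)
              (λ t a → nonzero (dual F t a)) X X∈
            nz = λ z → X≢0 (trans (sym (fix e λ t a → /⇒zero (member (dual F t a)))) z)
        in case lead-cases Z of λ
          { (inj₁ l) → - Z , record
             { member = symm Z Z∈
             ; ortho = λ t a ne → trans (neg-‼ Z (el t)) (cong negS (zs t (active⇒/ t ne a)))
             ; nonzero = λ z → negS-nonzero nz (trans (sym (neg-‼ Z e)) z)
             ; lead = lead-neg Z l }
          ; (inj₂ (inj₁ l)) → Z , record
             { member = Z∈ ; ortho = λ t a ne → zs t (active⇒/ t ne a) ; nonzero = nz ; lead = l }
          ; (inj₂ (inj₂ z)) → contradiction (z e) nz }

      D⁺ : Slot n → SignVec n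
      D⁺ t with t ≟ᵗ elem e
      ... | yes _ = proj₁ new-dual
      ... | no _ = D t

      D⁺-e : D⁺ (elem e) ≡ proj₁ new-dual
      D⁺-e with elem e ≟ᵗ elem e
      ... | yes _ = refl
      ... | no ne = contradiction refl ne

      D⁺-other : ∀ t → t ≢ elem e → D⁺ t ≡ D t
      D⁺-other t ne with t ≟ᵗ elem e
      ... | yes eq = contradiction eq ne
      ... | no _ = refl

      lift-frame : Frame W⁺ D⁺
      lift-frame = record { inactive = inactive⁺ ; dual = dual⁺ }
        where
        inactive⁺ : ∀ t → ¬ Active W⁺ t → ∀ h → D⁺ t ‼ h ≡ zer
        inactive⁺ t ¬a h with t ≟ᵗ elem e
        ... | yes refl = contradiction W⁺-e ¬a
        ... | no _ = inactive F t (λ a → ¬a (/⇒active t a)) h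
        dual⁺ : ∀ t → Active W⁺ t → Dual W⁺ t (D⁺ t)
        dual⁺ t a with t ≟ᵗ elem e
        ... | yes refl = proj₂ new-dual
        ... | no ne = record
              { member = /⇒∈ (member d)
              ; ortho = λ t' a' ne' → case t' ≟ᵗ elem e of λ
                  { (yes refl) → /⇒zero (member d)
                  ; (no t'≢) → ortho d t' (active⇒/ t' t'≢ a') ne' }
              ; nonzero = nonzero d
              ; lead = lead d }
          where
          d = dual F t (active⇒/ t ne a)

  -- The sign at `e` is not chosen but dictated by dual feasibility. Since `e` exceeds the support
  -- of `s`, the new slot `elem e` comes after every scale that covers an element of the sample.
  lift-solution : ∀ {s W D} → C/.Solution s W D → s e ≡ zer → (∀ i → s i ≢ zer → i < e) →
    ∀ X → X ∈ ℒ → X ‼ e ≢ zer →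
    Σ Sign λ σ → σ ≢ zer × Σ (Slot n → SignVec n) (Solution (s [ e ↦ σ ]) (W⁺ W))
  lift-solution {s} {W} {D} S se≡0 below X X∈ X≢0 = σ , nonzero dₑ , E , record
    { frame = lift-frame W F X X∈ X≢0 ; tight = tight⁺ ; covered = covered⁺ }
    where
    F = frame S
    E = D⁺ W F X X∈ X≢0
    dₑ = proj₂ (new-dual W F X X∈ X≢0)
    σ = proj₁ (new-dual W F X X∈ X≢0) ‼ e
    tight⁺ : ∀ i → lookup (W⁺ W) i ≡ true → E (elem i) ‼ i ≡ (s [ e ↦ σ ]) i
    tight⁺ i a = case i Fin.≟ e of λ
      { (yes refl) → trans (cong (_‼ e) (D⁺-e W F X X∈ X≢0)) (sym (update-same s e σ))
      ; (no ne) → trans (cong (_‼ i) (D⁺-other W F X X∈ X≢0 (elem i) λ { refl → ne refl }))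
          (trans (tight S i (W⁺⊆W W i ne a)) (sym (update-other s e σ i ne))) }
    covered⁺ : ∀ i → lookup (W⁺ W) i ≢ true → (s [ e ↦ σ ]) i ≢ zer → FirstAt E i ((s [ e ↦ σ ]) i)
    covered⁺ i ¬a nz = case i Fin.≟ e of λ
      { (yes refl) → contradiction (W⁺-e W) ¬a
      ; (no ne) →
          let eq = update-other s e σ i ne
              si≢0 = λ z → nz (trans eq z)
              t , t≺ , v , z = covered S i (λ a → ¬a (W⊆W⁺ W i a)) si≢0
              old : ∀ t' → t' ≺ elem i → E t' ≡ D t'
              old t' lt = D⁺-other W F X X∈ X≢0 t' λ { refl → case lt of λ { (elem<elem e<i) → ℕ.<-asym e<i (below i si≢0) } }
          in t , t≺ , trans (cong (_‼ i) (old t t≺)) (trans v (sym eq))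
             , λ t' lt → trans (cong (_‼ i) (old t' (≺-trans lt t≺))) (z t' lt) }

open Covectors.Dual
open Covectors.Frame
open Covectors.Solution

-- Induction on the last element e of the sample.  Deleting e from the sample gives a solution
-- that either fits s or lies on the wrong side of e; in the latter case the solution in the
-- contraction by e lifts, and solution-agree forces the sign of its lift at e to be s e.
solve : ∀ {n} m (ℒ : List (SignVec n)) (om : IsOM ℒ) (s : Fin n → Sign) → (∀ h → m ℕ.≤ toℕ h → s h ≡ zer) →
        ∀ X → X ∈ ℒ → (∀ h → s h ≢ zer → X ‼ h ≡ s h) →
        Σ (Subset n) λ W → Σ (Slot n → SignVec n) (Covectors.Solution ℒ om s W)
solve zero ℒ om s bound X X∈ X≥s = ⊥ , Covectors.⊥-solution ℒ om s λ i → bound i ℕ.z≤n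
solve {n} (suc m) ℒ om s bound X X∈ X≥s with m ℕ.<? n
... | no m≮n = solve m ℒ om s (λ h m≤h → contradiction (ℕ.≤-<-trans m≤h (Fin.toℕ<n h)) m≮n) X X∈ X≥s
... | yes m<n = case s e ≟ˢ zer of λ
    { (yes z) → solve m ℒ om s (λ h m≤h → case h Fin.≟ e of λ
        { (yes refl) → z ; (no ne) → bound h (beyond h ne m≤h) }) X X∈ X≥s
    ; (no nz) → nonzero-case nz }
  where
  e : Fin n
  e = fromℕ< m<n
  open Covectors ℒ om
  open Contraction ℒ om e
  toℕ-e : toℕ e ≡ m
  toℕ-e = Fin.toℕ-fromℕ< m<n
  beyond : ∀ h → h ≢ e → m ℕ.≤ toℕ h → suc m ℕ.≤ toℕ h
  beyond h ne m≤h = ℕ.≤∧≢⇒< m≤h λ eq → ne (Fin.toℕ-injective (trans (sym eq) (sym toℕ-e)))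
  s⁻ : Fin n → Sign
  s⁻ = s [ e ↦ zer ]
  s⁻-e : s⁻ e ≡ zer
  s⁻-e = update-same s e zer
  s⁻-other : ∀ i → i ≢ e → s⁻ i ≡ s i
  s⁻-other = update-other s e zer
  ≢e : ∀ {i} → s⁻ i ≢ zer → i ≢ e
  ≢e nz refl = nz s⁻-e
  bound⁻ : ∀ h → m ℕ.≤ toℕ h → s⁻ h ≡ zer
  bound⁻ h m≤h = case h Fin.≟ e of λ
    { (yes refl) → s⁻-e ; (no ne) → trans (s⁻-other h ne) (bound h (beyond h ne m≤h)) }
  below : ∀ i → s⁻ i ≢ zer → i < e
  below i nz = subst (toℕ i ℕ.<_) (sym toℕ-e) (ℕ.≰⇒> λ m≤i → nz (bound⁻ i m≤i))
  X≥s⁻ : ∀ h → s⁻ h ≢ zer → X ‼ h ≡ s⁻ h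
  X≥s⁻ h nz = trans (X≥s h λ z → nz (trans eq z)) (sym eq) where eq = s⁻-other h (≢e nz)
  nonzero-case : s e ≢ zer → Σ (Subset n) λ W → Σ (Slot n → SignVec n) (Solution s W)
  nonzero-case nz = case first-nonzero D e of λ
      { (inj₁ z) → contradiction z (frame-spans (frame S) e X X∈ λ z → nz (trans (sym (X≥s e nz)) z))
      ; (inj₂ (t , nzt , zs)) → decide t nzt zs }
    where
    sol = solve m ℒ om s⁻ bound⁻ X X∈ X≥s⁻
    W = proj₁ sol
    D = proj₁ (proj₂ sol)
    S = proj₂ (proj₂ sol)
    X-e : X ‼ e ≡ s e
    X-e = X≥s e nz
    module _ (t : Slot n) (nzt : D t ‼ e ≢ zer) (zs : ∀ t' → t' ≺ t → D t' ‼ e ≡ zer) where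
      t≺e : t ≺ elem e
      t≺e = go t nzt
        where
        go : ∀ t → D t ‼ e ≢ zer → t ≺ elem e
        go (box _) _ = box<elem
        go (elem j) nzj with Active? W (elem j)
        ... | yes a = elem<elem (below j (solution-support S j a))
        ... | no ¬a = contradiction (inactive (frame S) (elem j) ¬a e) nzj
      extended : ∀ s' → s' e ≡ D t ‼ e → (∀ i → i ≢ e → s' i ≡ s⁻ i) → Solution s' W D
      extended s' at off = record
        { frame = frame S
        ; tight = λ i a → trans (tight S i a) (sym (off i (≢e (solution-support S i a))))
        ; covered = λ i ¬a nz' → case i Fin.≟ e of λ
            { (yes refl) → t , t≺e , sym at , zs
            ; (no ne) →
                let t₁ , lt , v , z = covered S i ¬a λ z → nz' (trans (off i ne) z)
                in t₁ , lt , trans v (sym (off i ne)) , z } }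
      -- The vertex is completed by X and not by a tope, because iterated contractions have loops. Y
      -- has the signs of `s⁻` on its support and the sign of `D t` at `e`. If the latter is wrong,
      -- eliminating `e` between X and Y gives a covector of the contraction that fits `s⁻`.
      Y = point D X
      Y∈ : Y ∈ ℒ
      Y∈ = point-∈ D X (frame-∈ (frame S)) X∈
      Y-e : Y ‼ e ≡ D t ‼ e
      Y-e = point-first D X t e zs nzt
      contracted : s e ≢ D t ‼ e → Σ (SignVec n) λ Z → Z ∈ ℒ / e × (∀ h → s⁻ h ≢ zer → Z ‼ h ≡ s⁻ h)
      contracted ne =
        let Z , Z∈ , Ze , off = se X Y X∈ Y∈ e (subst₂ Opp (sym X-e) (sym Y-e) (≢⇒Opp nz nzt ne))
        in Z , ∈⇒/ Z∈ Ze , λ h nzh →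
             let x = X≥s⁻ h nzh
                 y = solution-point S X h nzh
             in trans (off h (¬Opp-≡ (trans x (sym y)))) (trans (∘-‼ X Y h) (trans (cong₂ _∘ₛ_ x y) (∘ₛ-idem _)))
      decide : Σ (Subset n) λ W → Σ (Slot n → SignVec n) (Solution s W)
      decide = case s e ≟ˢ D t ‼ e of λ
        { (yes eq) → W , D , extended s eq (λ i ne → sym (s⁻-other i ne))
        ; (no ne) →
            let Z , Z∈ , Z≥s⁻ = contracted ne
                W₁ , D₁ , S₁ = solve m (ℒ / e) om/e s⁻ bound⁻ Z Z∈ Z≥s⁻
                σ , σ≢0 , D₂ , S₂ = lift-solution S₁ s⁻-e below X X∈ (λ z → nz (trans (sym X-e) z))
            in case s e ≟ˢ σ of λ
              { (yes eq) → W⁺ W₁ , D₂ , solution-cong (λ i → case i Fin.≟ e of λ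
                  { (yes refl) → trans (update-same s⁻ e σ) (sym eq)
                  ; (no i≢e) → trans (update-other s⁻ e σ i i≢e) (s⁻-other i i≢e) }) S₂
              -- Here `σ` and the sign of `D t` at `e` both differ from `s e`, so they coincide, and
              -- `W` solves the same sample as the lift. Uniqueness puts `e` into `W`, outside the
              -- support of `s⁻`.
              ; (no ne') → contradiction s⁻-e (solution-support S e
                  (proj₁ (solution-agree S₂
                    (extended (s⁻ [ e ↦ σ ]) (trans (update-same s⁻ e σ) (third nz σ≢0 nzt ne' ne)) (update-other s⁻ e σ))
                    (elem e)) (W⁺-e W₁))) } }

-- The tope graph

toSubset : ∀ {n} {P : Fin n → Set} → (∀ h → Dec (P h)) → Subset n
toSubset P? = tabulate λ h → does (P? h)

∈-toSubset⁺ : ∀ {n} {P : Fin n → Set} (P? : ∀ h → Dec (P h)) {h} → P h → h ∈ˢ toSubset P?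
∈-toSubset⁺ P? {h} p = lookup⇒[]= h _ (trans (lookup∘tabulate _ h) (dec-true (P? h) p))

∈-toSubset⁻ : ∀ {n} {P : Fin n → Set} (P? : ∀ h → Dec (P h)) {h} → h ∈ˢ toSubset P? → P h
∈-toSubset⁻ P? {h} h∈ with P? h | trans (sym (lookup∘tabulate (λ h → does (P? h)) h)) ([]=⇒lookup h∈)
... | yes p | _ = p
... | no _ | ()

toSubset-mono : ∀ {n} {P Q : Fin n → Set} (P? : ∀ h → Dec (P h)) (Q? : ∀ h → Dec (Q h)) →
  (∀ h → P h → Q h) → ∣ toSubset P? ∣ ℕ.≤ ∣ toSubset Q? ∣
toSubset-mono P? Q? P⇒Q = p⊆q⇒∣p∣≤∣q∣ λ h∈ → ∈-toSubset⁺ Q? (P⇒Q _ (∈-toSubset⁻ P? h∈))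

toSubset-mono-< : ∀ {n} {P Q : Fin n → Set} (P? : ∀ h → Dec (P h)) (Q? : ∀ h → Dec (Q h)) →
  (∀ h → P h → Q h) → ∀ h → Q h → ¬ P h → ∣ toSubset P? ∣ ℕ.< ∣ toSubset Q? ∣
toSubset-mono-< P? Q? P⇒Q h q ¬p = p⊂q⇒∣p∣<∣q∣
  ((λ h∈ → ∈-toSubset⁺ Q? (P⇒Q _ (∈-toSubset⁻ P? h∈))) , h , ∈-toSubset⁺ Q? q , λ h∈ → ¬p (∈-toSubset⁻ P? h∈))

∀-sign? : ∀ {P : Sign → Set} → (∀ a → Dec (P a)) → Dec (∀ a → P a)
∀-sign? P? = map′ (λ { (p , q , r) → λ { pos → p ; neg → q ; zer → r } }) (λ f → f pos , f neg , f zer)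
  (P? pos ×-dec P? neg ×-dec P? zer)

OneOf : Sign → Sign → Sign → Sign → Set
OneOf a b r q = (r ≡ a × q ≢ b) ⊎ (r ≢ a × q ≡ b)

-- The hypotheses say that, after reorienting so that `a` and `b` are positive, `x` and `y` differ.
-- Filling the zeros with the given signs or with their negatives then matches exactly one of `a`,
-- `b`. Checked by evaluating all sign combinations.
separate : ∀ a b x y → a ≢ zer → b ≢ zer → (a ≡ b → x ≢ y) → (a ≢ b → x ≢ negS y) →
  OneOf a b (x ∘ₛ a) (y ∘ₛ b) ⊎ OneOf a b (x ∘ₛ negS a) (y ∘ₛ negS b)
separate = from-yes (∀-sign? λ a → ∀-sign? λ b → ∀-sign? λ x → ∀-sign? λ y →
  ¬? (a ≟ˢ zer) →-dec ¬? (b ≟ˢ zer) →-dec ((a ≟ˢ b) →-dec ¬? (x ≟ˢ y)) →-dec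
  (¬? (a ≟ˢ b) →-dec ¬? (x ≟ˢ negS y)) →-dec
  (oneOf? a b (x ∘ₛ a) (y ∘ₛ b) ⊎-dec oneOf? a b (x ∘ₛ negS a) (y ∘ₛ negS b)))
  where
  oneOf? : ∀ a b r q → Dec (OneOf a b r q)
  oneOf? a b r q = ((r ≟ˢ a) ×-dec ¬? (q ≟ˢ b)) ⊎-dec (¬? (r ≟ˢ a) ×-dec (q ≟ˢ b))

¬negS⇒¬Opp : ∀ {a b} → b ≢ negS a → ¬ Opp a b
¬negS⇒¬Opp ne (inj₁ (refl , refl)) = ne refl
¬negS⇒¬Opp ne (inj₂ (refl , refl)) = ne refl

zero-or-same : ∀ {a b} → a ≢ zer → b ≢ negS a → b ≢ a → b ≡ zer
zero-or-same {a} {zer} _ _ _ = refl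
zero-or-same {pos} {pos} _ _ c = contradiction refl c
zero-or-same {pos} {neg} _ b _ = contradiction refl b
zero-or-same {neg} {pos} _ b _ = contradiction refl b
zero-or-same {neg} {neg} _ _ c = contradiction refl c
zero-or-same {zer} a _ _ = contradiction refl a

negS-≢ : ∀ {a} → a ≢ zer → negS a ≢ a
negS-≢ {pos} _ ()
negS-≢ {neg} _ ()
negS-≢ {zer} a≢0 _ = a≢0 refl

module TopeGraph {n : ℕ} (ℒ : List (SignVec n)) (om : IsOM ℒ) (simple : Simple ℒ) where
  open Covectors ℒ om

  module _ (U : SignVec n) (U∈ : U ∈ ℒ) (full : ∀ h → U ‼ h ≢ zer) where

    differ? : ∀ Z h → Dec (Z ‼ h ≢ U ‼ h)
    differ? Z h = ¬? (Z ‼ h ≟ˢ U ‼ h)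

    opposite? : ∀ Z h → Dec (Z ‼ h ≡ negS (U ‼ h))
    opposite? Z h = Z ‼ h ≟ˢ negS (U ‼ h)

    Flip : Fin n → Set
    Flip e = Σ (SignVec n) λ Y → Y ∈ ℒ × Y ‼ e ≡ negS (U ‼ e) × (∀ h → h ≢ e → Y ‼ h ≡ U ‼ h)

    separating : ∀ e f → e ≢ f → Σ (SignVec n) λ X → X ∈ ℒ
      × (U ‼ e ≡ U ‼ f → X ‼ e ≢ X ‼ f) × (U ‼ e ≢ U ‼ f → X ‼ e ≢ negS (X ‼ f))
    separating e f ne with U ‼ e ≟ˢ U ‼ f | proj₂ simple e f ne
    ... | yes eq | (X , X∈ , d) , _ = X , X∈ , (λ _ → d) , λ ne → contradiction eq ne
    ... | no neq | _ , (X , X∈ , d) = X , X∈ , (λ eq → contradiction eq neq) , λ _ → d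

    opposite⇒differ : ∀ {Z h} → Z ‼ h ≡ negS (U ‼ h) → Z ‼ h ≢ U ‼ h
    opposite⇒differ {h = h} o eq = negS-≢ (full h) (trans (sym o) eq)

    -- Elimination between U and Z keeps U outside the separator. So the new covector can differ
    -- from U only where Z was opposite to it, and at `g` it is now zero.
    remove-opposite : ∀ Z → Z ∈ ℒ → ∀ g → Z ‼ g ≡ negS (U ‼ g) →
      Σ (SignVec n) λ Z' → Z' ∈ ℒ × Z' ‼ g ≡ zer × (∀ h → Z' ‼ h ≢ U ‼ h → Z ‼ h ≡ negS (U ‼ h))
    remove-opposite Z Z∈ g opp =
      let Z' , Z'∈ , Z'g , off = se U Z U∈ Z∈ g (subst (Opp _) (sym opp) (Opp-negS (full g)))
      in Z' , Z'∈ , Z'g , λ h d → decidable-stable (opposite? Z h) λ ¬opp →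
           d (trans (off h (¬negS⇒¬Opp ¬opp)) (trans (∘-‼ U Z h) (∘ₛ-nonzeroˡ _ _ (full h))))

    module _ (Z : SignVec n) (Z∈ : Z ∈ ℒ) (¬opp : ∀ h → Z ‼ h ≢ negS (U ‼ h)) where

      vanish : ∀ h → Z ‼ h ≢ U ‼ h → Z ‼ h ≡ zer
      vanish h = zero-or-same (full h) (¬opp h)

      ∘-keeps : ∀ Y h → Z ‼ h ≡ U ‼ h → (Z ∘ Y) ‼ h ≡ U ‼ h
      ∘-keeps Y h same = trans (∘-‼ Z Y h) (trans (∘ₛ-nonzeroˡ _ _ λ z → full h (trans (sym same) z)) same)

      ∘-vanish : ∀ Y h → Z ‼ h ≢ U ‼ h → (Z ∘ Y) ‼ h ≡ Y ‼ h
      ∘-vanish Y h d = trans (∘-‼ Z Y h) (∘ₛ-zeroˡ (vanish h d))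

      flip-single : ∀ e → Z ‼ e ≢ U ‼ e → (∀ h → h ≢ e → Z ‼ h ≡ U ‼ h) → Flip e
      flip-single e d same = Z ∘ (- U) , comp _ _ Z∈ (symm U U∈)
        , trans (∘-vanish (- U) e d) (neg-‼ U e) , λ h h≢e → ∘-keeps (- U) h (same h h≢e)

      -- Simplicity supplies a covector that tells `e` and `f` apart relative to U. Composed with U
      -- or its negative, it agrees with U at exactly one of them, and placing it below Z refills
      -- the zeros of Z accordingly.
      split : ∀ e f → e ≢ f → Z ‼ e ≢ U ‼ e → Z ‼ f ≢ U ‼ f →
        Σ (SignVec n) λ T → T ∈ ℒ × (∀ h → T ‼ h ≢ U ‼ h → Z ‼ h ≢ U ‼ h)
          × Σ (Fin n) λ g → Z ‼ g ≢ U ‼ g × T ‼ g ≡ U ‼ g × Σ (Fin n) λ g' → T ‼ g' ≢ U ‼ g'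
      split e f e≢f de df =
        let X , X∈ , s₁ , s₂ = separating e f e≢f
        in case separate _ _ (X ‼ e) (X ‼ f) (full e) (full f) s₁ s₂ of λ
          { (inj₁ one) → finish (X ∘ U) (comp _ _ X∈ U∈) (subst₂ (OneOf _ _) (sym (∘-‼ X U e)) (sym (∘-‼ X U f)) one)
          ; (inj₂ one) → finish (X ∘ (- U)) (comp _ _ X∈ (symm U U∈)) (subst₂ (OneOf _ _)
              (sym (trans (∘-‼ X (- U) e) (cong (X ‼ e ∘ₛ_) (neg-‼ U e))))
              (sym (trans (∘-‼ X (- U) f) (cong (X ‼ f ∘ₛ_) (neg-‼ U f)))) one) }
        where
        finish : ∀ Y → Y ∈ ℒ → OneOf (U ‼ e) (U ‼ f) (Y ‼ e) (Y ‼ f) → _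
        finish Y Y∈ one = Z ∘ Y , comp _ _ Z∈ Y∈ , (λ h d same → d (∘-keeps Y h same)) , (case one of λ
          { (inj₁ (p , q)) → e , de , trans (∘-vanish Y e de) p , f , λ eq → q (trans (sym (∘-vanish Y f df)) eq)
          ; (inj₂ (p , q)) → f , df , trans (∘-vanish Y f df) q , e , λ eq → p (trans (sym (∘-vanish Y e de)) eq) })

    FlipBelow : ℕ → Set
    FlipBelow k = ∀ Z → Z ∈ ℒ → ∣ toSubset (differ? Z) ∣ ℕ.< k →
      ∀ e → Z ‼ e ≢ U ‼ e → Σ (Fin n) λ f → Z ‼ f ≢ U ‼ f × Flip f

    -- Eliminate against U as long as Z is opposite to U somewhere; once Z ≤ U vanishes at two
    -- elements, simplicity gives a covector that differs from U on a smaller set.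
    flip-step : ∀ {k} → FlipBelow k → ∀ l Z → Z ∈ ℒ →
      ∣ toSubset (differ? Z) ∣ ℕ.< suc k → ∣ toSubset (opposite? Z) ∣ ℕ.< l →
      ∀ e → Z ‼ e ≢ U ‼ e → Σ (Fin n) λ f → Z ‼ f ≢ U ‼ f × Flip f
    flip-step rec (suc l) Z Z∈ <k <l e de with Fin.any? (opposite? Z)
    ... | yes (g , opp) =
      let Z' , Z'∈ , Z'g , reflects = remove-opposite Z Z∈ g opp
          f , d , flip = flip-step rec l Z' Z'∈
            (ℕ.≤-<-trans (toSubset-mono (differ? Z') (differ? Z) λ h d → opposite⇒differ {Z} (reflects h d)) <k)
            (ℕ.<-≤-trans (toSubset-mono-< (opposite? Z') (opposite? Z)
              (λ h o → reflects h (opposite⇒differ {Z'} o)) g opp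
              λ o → negS-nonzero (full g) (trans (sym o) Z'g)) (ℕ.s≤s⁻¹ <l))
            g (λ eq → full g (trans (sym eq) Z'g))
      in f , opposite⇒differ {Z} (reflects f d) , flip
    ... | no ¬opp with Fin.any? (λ f → ¬? (f Fin.≟ e) ×-dec differ? Z f)
    ...   | no alone = e , de , flip-single Z Z∈ (λ h o → ¬opp (h , o)) e de
              λ h h≢e → decidable-stable (Z ‼ h ≟ˢ U ‼ h) λ d → alone (h , h≢e , d)
    ...   | yes (f , f≢e , df) =
      let T , T∈ , reflects , g , dg , same , g' , dg' =
            split Z Z∈ (λ h o → ¬opp (h , o)) e f (λ eq → f≢e (sym eq)) de df
          h , d , flip = rec T T∈
            (ℕ.<-≤-trans (toSubset-mono-< (differ? T) (differ? Z) reflects g dg λ d → d same) (ℕ.s≤s⁻¹ <k)) g' dg'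
      in h , reflects h d , flip

    flip-exists : ∀ k → FlipBelow k
    -- At most `n` elements are opposite, so `suc n` bounds the inner induction.
    flip-exists (suc k) Z Z∈ <k = flip-step (flip-exists k) (suc n) Z Z∈ <k (ℕ.s≤s (∣p∣≤n (toSubset (opposite? Z))))

  ↑-injective : ∀ {a b} → ↑ a ≡ ↑ b → a ≡ b
  ↑-injective {⊕} {⊕} _ = refl
  ↑-injective {⊖} {⊖} _ = refl

  -- Isometry of the tope graph in local form: some edge at `u` leads one step closer to `v`.
  adjacent : ∀ u v → Topes ℒ u → Topes ℒ v → ∀ e → lookup u e ≢ lookup v e →
    Σ (Fin n) λ f → lookup u f ≢ lookup v f × Topes ℒ (flipAt f u)
  adjacent u v u∈ v∈ e ne =
    let f , d , Y , Y∈ , at , off = flip-exists (map ↑ u) u∈ full _ (map ↑ v) v∈ ℕ.≤-refl e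
          (λ eq → ne (sym (↑-injective (trans (sym (lookup-map e ↑ v)) (trans eq (lookup-map e ↑ u))))))
    in f , (λ eq → d (trans (lookup-map f ↑ v) (trans (cong ↑ (sym eq)) (sym (lookup-map f ↑ u)))))
     , subst (_∈ ℒ) (lookup-ext λ h → trans (flipped f Y at off h) (sym (lookup-map h ↑ (flipAt f u)))) Y∈
    where
    full : ∀ h → map ↑ u ‼ h ≢ zer
    full h eq with lookup u h | trans (sym (lookup-map h ↑ u)) eq
    ... | ⊕ | ()
    ... | ⊖ | ()
    ↑-flip : ∀ a → negS (↑ a) ≡ ↑ (flipPM a)
    ↑-flip ⊕ = refl
    ↑-flip ⊖ = refl
    flipped : ∀ f Y → Y ‼ f ≡ negS (map ↑ u ‼ f) → (∀ h → h ≢ f → Y ‼ h ≡ map ↑ u ‼ h) →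
              ∀ h → Y ‼ h ≡ ↑ (lookup (flipAt f u) h)
    flipped f Y at off h with h Fin.≟ f
    ... | yes refl = trans at (trans (cong negS (lookup-map f ↑ u)) (trans (↑-flip _) (cong ↑ (sym (lookup∘updateAt f u)))))
    ... | no ne = trans (off h ne) (trans (lookup-map h ↑ u) (cong ↑ (sym (lookup∘updateAt′ h f ne u))))

-- The compression scheme

toPM : Sign → PM
toPM pos = ⊕
toPM neg = ⊖
toPM zer = ⊖

toPM-↑ : ∀ a → toPM (↑ a) ≡ a
toPM-↑ ⊕ = refl
toPM-↑ ⊖ = refl

↑-toPM : ∀ {a} → a ≢ zer → ↑ (toPM a) ≡ a
↑-toPM {pos} _ = refl
↑-toPM {neg} _ = refl
↑-toPM {zer} a≢0 = contradiction refl a≢0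

map-↑-toPM : ∀ {n} (X : SignVec n) → (∀ h → X ‼ h ≢ zer) → map ↑ (map toPM X) ≡ X
map-↑-toPM X full = lookup-ext λ h → trans (lookup-map h ↑ (map toPM X)) (trans (cong ↑ (lookup-map h toPM X)) (↑-toPM (full h)))

map-toPM-↑ : ∀ {n} (v : PMVec n) → map toPM (map ↑ v) ≡ v
map-toPM-↑ v = trans (sym (map-∘ toPM ↑ v)) (trans (map-cong toPM-↑ v) (map-id v))

↑-nonzero : ∀ a → ↑ a ≢ zer
↑-nonzero ⊕ ()
↑-nonzero ⊖ ()

_≟ᵖ_ : DecidableEquality PM
⊕ ≟ᵖ ⊕ = yes refl
⊕ ≟ᵖ ⊖ = no λ ()
⊖ ≟ᵖ ⊕ = no λ ()
⊖ ≟ᵖ ⊖ = yes refl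

module Scheme {n : ℕ} (ℒ : List (SignVec n)) (om : IsOM ℒ) where
  open Covectors ℒ om

  tope-full : ∀ (v : PMVec n) h → map ↑ v ‼ h ≢ zer
  tope-full v h z = ↑-nonzero (lookup v h) (trans (sym (lookup-map h ↑ v)) z)

  Full : SignVec n → Set
  Full X = ∀ h → X ‼ h ≢ zer

  full? : ∀ X → Dec (Full X)
  full? X = Fin.all? λ h → ¬? (X ‼ h ≟ˢ zer)

  baseTope : SignVec n
  baseTope with Any.any? full? ℒ
  ... | yes p = proj₁ (find p)
  -- Reached only if there are no topes, and then no sample is realizable.
  ... | no _ = zeroVec

  baseTope-spec : ∀ v → Topes ℒ v → baseTope ∈ ℒ × Full baseTope
  baseTope-spec v v∈ with Any.any? full? ℒ
  ... | yes p = proj₂ (find p)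
  ... | no ¬p = contradiction (lose v∈ (tope-full v)) ¬p

  dual? : ∀ W t X → X ∈ ℒ → Dec (Dual W t X)
  dual? W t X X∈ = map′
    (λ { (o , nz , l) → record { member = X∈ ; ortho = o ; nonzero = nz ; lead = l } })
    (λ d → ortho d , nonzero d , lead d)
    (ortho? ×-dec ¬? (X ‼ el t ≟ˢ zer)
      ×-dec Fin.any? λ i → (X ‼ i ≟ˢ dir t) ×-dec Fin.all? λ h → (i Fin.<? h) →-dec (X ‼ h ≟ˢ zer))
    where
    ortho? : Dec (∀ t' → Active W t' → t' ≢ t → X ‼ el t' ≡ zer)
    ortho? = map′ (λ { (b , e) → λ { (box i) → b i ; (elem i) → e i } })
      (λ o → (λ i → o (box i)) , λ i → o (elem i))
      (Fin.all? (λ i → at (box i)) ×-dec Fin.all? (λ i → at (elem i)))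
      where
      at : ∀ t' → Dec (Active W t' → t' ≢ t → X ‼ el t' ≡ zer)
      at t' = Active? W t' →-dec ¬? (t' ≟ᵗ t) →-dec (X ‼ el t' ≟ˢ zer)

  search-dual : ∀ W t → Dec (Σ (SignVec n) (Dual W t))
  search-dual W t = map′ to (λ { (X , d) → lose (member d) (member d , d) }) (Any.any? dual∈? ℒ)
    where
    to : Any (λ X → X ∈ ℒ × Dual W t X) ℒ → Σ (SignVec n) (Dual W t)
    to p = let X , _ , _ , d = find p in X , d
    dual∈? : ∀ X → Dec (X ∈ ℒ × Dual W t X)
    dual∈? X with Any.any? (≡-dec _≟ˢ_ X) ℒ
    ... | no X∉ = no λ { (X∈ , _) → X∉ X∈ }
    ... | yes X∈ = map′ (X∈ ,_) proj₂ (dual? W t X X∈)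

  -- The decoder's reconstruction of the frame from W alone, by search. By `dual-unique` it finds
  -- exactly the vectors that the encoder used.
  duals : Subset n → Slot n → SignVec n
  duals W t with Active? W t | search-dual W t
  ... | yes _ | yes (X , _) = X
  ... | _ | _ = zeroVec

  duals-frame : ∀ {W D} → Frame W D → ∀ t → duals W t ≡ D t
  duals-frame {W} {D} F t with Active? W t | search-dual W t
  ... | yes a | yes (X , d) = dual-unique d (dual F t a)
  ... | yes a | no ¬d = contradiction (D t , dual F t a) ¬d
  ... | no ¬a | _ = lookup-ext λ h → trans (lookup-replicate h zer) (sym (inactive F t ¬a h))

  β : Subset n → PMVec n
  β W = map toPM (point (duals W) baseTope)

  Fits : SignVec n → SignVec n → Set
  Fits s X = ∀ h → s ‼ h ≢ zer → X ‼ h ≡ s ‼ h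

  fits? : ∀ s X → Dec (Fits s X)
  fits? s X = Fin.all? λ h → ¬? (s ‼ h ≟ˢ zer) →-dec (X ‼ h ≟ˢ s ‼ h)

  solve-fitting : ∀ s → Any (Fits s) ℒ → Σ (Subset n) λ W → Σ (Slot n → SignVec n) (Solution (lookup s) W)
  solve-fitting s p =
    let X , X∈ , fits = find p
    in solve n ℒ om (lookup s) (λ h n≤h → contradiction (Fin.toℕ<n h) (ℕ.≤⇒≯ n≤h)) X X∈ fits

  α : SignVec n → Subset n
  α s with Any.any? (fits? s) ℒ
  ... | yes p = proj₁ (solve-fitting s p)
  ... | no _ = ⊥

  realizable⇒fits : ∀ s → Realizable (Topes ℒ) s → Any (Fits s) ℒ
  realizable⇒fits s (c , c∈ , s≼c) = lose c∈ λ h nz → case s≼c h of λ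
    { (inj₁ z) → contradiction z nz ; (inj₂ eq) → trans (lookup-map h ↑ c) (sym eq) }

  α-solution : ∀ s → Realizable (Topes ℒ) s → Σ (Slot n → SignVec n) (Solution (lookup s) (α s))
  α-solution s r with Any.any? (fits? s) ℒ
  ... | yes p = proj₂ (solve-fitting s p)
  ... | no ¬p = contradiction (realizable⇒fits s r) ¬p

  -- The dual of each element of W vanishes on the rest of W, so its sign there can be chosen
  -- independently. Composing these duals above a tope realizes any pattern on W.
  shattered : ∀ {W D} → Frame W D → ∀ v → Topes ℒ v → Shattered (Topes ℒ) W
  shattered {W} {D} F v v∈ p = map toPM X , subst (_∈ ℒ) (sym (map-↑-toPM X X-full)) X∈ , at
    where
    B∈ = proj₁ (baseTope-spec v v∈)
    B-full = proj₂ (baseTope-spec v v∈)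
    g : Fin n → SignVec n
    -- `orient` produces the sign opposite to its first argument, hence the `negS`.
    g j = orient (negS (↑ (lookup p j))) (D (elem j)) j
    X = compose g baseTope
    X-full : Full X
    X-full h = compose-supp g baseTope h (B-full h)
    g∈ : ∀ j → g j ∈ ℒ ⊎ (∀ h → g j ‼ h ≡ zer)
    g∈ j = case frame-∈ F (elem j) of λ
      { (inj₁ m) → inj₁ (orient-∈ _ (D (elem j)) j m)
      ; (inj₂ z) → inj₂ λ h → orient-zero _ (D (elem j)) j h (z h) }
    X∈ : X ∈ ℒ
    X∈ = compose-∈ g baseTope g∈ B∈
    unopp : ∀ a {b} → Opp (negS (↑ a)) b → b ≡ ↑ a
    unopp ⊕ (inj₂ (_ , eq)) = eq
    unopp ⊖ (inj₁ (_ , eq)) = eq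
    at : ∀ e → e ∈ˢ W → lookup (map toPM X) e ≡ lookup p e
    at e e∈ = trans (lookup-map e toPM X) (trans (cong toPM X-e) (toPM-↑ _))
      where
      a = []=⇒lookup e∈
      g-e : g e ‼ e ≡ ↑ (lookup p e)
      g-e = case orient-opp (negS (↑ (lookup p e))) (D (elem e)) e (nonzero (dual F (elem e) a)) of λ
        { (inj₁ z) → contradiction z (negS-nonzero (↑-nonzero _))
        ; (inj₂ op) → unopp _ op }
      off : ∀ j → j < e → g j ‼ e ≡ zer
      off j j<e = orient-zero _ (D (elem j)) j e (case Active? W (elem j) of λ
        { (yes aj) → ortho (dual F (elem j) aj) (elem e) a λ { refl → ℕ.<-irrefl refl j<e }
        ; (no ¬aj) → inactive F (elem j) ¬aj e })
      X-e : X ‼ e ≡ ↑ (lookup p e)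
      X-e = trans (compose-first g baseTope e e off λ z → ↑-nonzero _ (trans (sym g-e) z)) g-e

  α-shattered : ∀ s → Realizable (Topes ℒ) s → Shattered (Topes ℒ) (α s)
  α-shattered s r@(c , c∈ , _) = shattered (frame (proj₂ (α-solution s r))) c c∈

  α-support : ∀ s → Realizable (Topes ℒ) s → ∀ e → e ∈ˢ α s → s ‼ e ≢ zer
  α-support s r e e∈ = solution-support (proj₂ (α-solution s r)) e ([]=⇒lookup e∈)

  β-tope : ∀ s → Realizable (Topes ℒ) s → map ↑ (β (α s)) ≡ point (duals (α s)) baseTope × Topes ℒ (β (α s))
  β-tope s r@(c , c∈ , _) = eq , subst (_∈ ℒ) (sym eq) P∈
    where
    S = proj₂ (α-solution s r)
    B = baseTope-spec c c∈
    P = point (duals (α s)) baseTope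
    P∈ : P ∈ ℒ
    P∈ = point-∈ (duals (α s)) baseTope
      (λ t → subst (λ X → X ∈ ℒ ⊎ (∀ h → X ‼ h ≡ zer)) (sym (duals-frame (frame S) t)) (frame-∈ (frame S) t)) (proj₁ B)
    eq : map ↑ (β (α s)) ≡ P
    eq = map-↑-toPM P λ h → point-supp (duals (α s)) baseTope h (proj₂ B h)

  β-consistent : ∀ s → Realizable (Topes ℒ) s → s ≼ β (α s)
  β-consistent s r e with s ‼ e ≟ˢ zer
  ... | yes z = inj₁ z
  ... | no nz = inj₂ (sym (trans (sym (lookup-map e ↑ (β (α s)))) (trans
          (cong (_‼ e) (trans (proj₁ (β-tope s r)) (point-cong baseTope (duals-frame F))))
          (solution-point S baseTope e nz))))
    where
    S = proj₂ (α-solution s r)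
    F = frame S

-- The reconstructible map

module Reconstruction {n : ℕ} (ℒ : List (SignVec n)) (om : IsOM ℒ) (simple : Simple ℒ) where
  open Scheme ℒ om
  open TopeGraph ℒ om simple

  G : Pred (PMVec n) 0ℓ
  G = Topes ℒ

  tope? : ∀ v → Dec (G v)
  tope? v = Any.any? (≡-dec _≟ˢ_ (map ↑ v)) ℒ

  module Convex (C : Pred (PMVec n) 0ℓ) (c : IsConvex G C) where

    v₀ : PMVec n
    v₀ = proj₁ (proj₁ c)

    v₀∈ : C v₀
    v₀∈ = proj₂ (proj₁ c)

    F : HalfspaceFamily G
    F = proj₁ (proj₂ c)

    ⇒⋂ : ∀ {v} → C v → ⋂H G F v
    ⇒⋂ {v} = proj₁ (proj₂ (proj₂ c) v)

    ⋂⇒ : ∀ {v} → ⋂H G F v → C v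
    ⋂⇒ {v} = proj₂ (proj₂ (proj₂ c) v)

    -- The predicate is arbitrary, but its boolean halfspace family and the finite list of covectors
    -- make membership decidable.
    C? : ∀ v → Dec (C v)
    C? v = map′ ⋂⇒ ⇒⋂ (tope? v ×-dec Fin.all? λ e → map′
      (λ { (p , m) → λ { ⊕ → p ; ⊖ → m } }) (λ f → f ⊕ , f ⊖) (at e ⊕ ×-dec at e ⊖))
      where
      at : ∀ e s → Dec (F e s ≡ true → lookup v e ≡ s)
      at e s = (F e s Bool.≟ true) →-dec (lookup v e ≟ᵖ s)

    osc? : ∀ e → Dec (_∈osc_ G e C)
    osc? e = map′ to from (Any.any? (λ X → at? (map toPM X)) ℒ)
      where
      At : PMVec n → Set
      At u = C u × G (flipAt e u) × ¬ C (flipAt e u)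
      at? : ∀ u → Dec (At u)
      at? u = C? u ×-dec tope? (flipAt e u) ×-dec ¬? (C? (flipAt e u))
      to : Any (λ X → At (map toPM X)) ℒ → Σ (PMVec n) At
      to p = let X , _ , a = find p in map toPM X , a
      from : Σ (PMVec n) At → Any (λ X → At (map toPM X)) ℒ
      from (u , a) = lose (proj₁ (⇒⋂ (proj₁ a))) (subst At (sym (map-toPM-↑ u)) a)

    -- If two members differed at `e`, no halfspace of `e` would occur in `F`, so a tope reached
    -- from C by flipping `e` would still lie in C.
    osc-constant : ∀ {e} → _∈osc_ G e C → ∀ {v w} → C v → C w → lookup v e ≡ lookup w e
    osc-constant {e} (u , u∈ , f∈ , f∉) {v} {w} v∈ w∈ = decidable-stable (lookup v e ≟ᵖ lookup w e) λ ne →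
      f∉ (⋂⇒ (f∈ , λ e' s Fes → case e' Fin.≟ e of λ
        { (yes refl) → contradiction (trans (proj₂ (⇒⋂ v∈) e s Fes) (sym (proj₂ (⇒⋂ w∈) e s Fes))) ne
        ; (no e'≢e) → trans (lookup∘updateAt′ e' e e'≢e u) (proj₂ (⇒⋂ u∈) e' s Fes) }))

    entry : Fin n → Sign
    entry e with osc? e
    ... | yes _ = ↑ (lookup v₀ e)
    ... | no _ = zer

    sample : SignVec n
    sample = tabulate entry

    sample-osc : ∀ {e} → sample ‼ e ≢ zer → _∈osc_ G e C
    sample-osc {e} nz with osc? e | lookup∘tabulate entry e
    ... | yes o | _ = o
    ... | no _ | eq = contradiction eq nz

    osc-sample : ∀ {e} → _∈osc_ G e C → sample ‼ e ≡ ↑ (lookup v₀ e)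
    osc-sample {e} o with osc? e | lookup∘tabulate entry e
    ... | yes _ | eq = eq
    ... | no ¬o | _ = contradiction o ¬o

    sample-realizable : Realizable G sample
    sample-realizable = v₀ , proj₁ (⇒⋂ v₀∈) , λ e → case sample ‼ e ≟ˢ zer of λ
      { (yes z) → inj₁ z ; (no nz) → inj₂ (osc-sample (sample-osc nz)) }

    differ?ᵖ : (u w : PMVec n) → ∀ h → Dec (lookup u h ≢ lookup w h)
    differ?ᵖ u w h = ¬? (lookup u h ≟ᵖ lookup w h)

    -- Walk from u towards T: a step leaving C would cross an element of osc C, on which T
    -- agrees with C.
    reach : ∀ T → G T → sample ≼ T → ∀ k u → C u → ∣ toSubset (differ?ᵖ u T) ∣ ℕ.< k → C T
    reach T T∈ fit (suc k) u u∈ <k with Fin.any? (differ?ᵖ u T)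
    ... | no none = subst C (lookup-ext λ h → decidable-stable (lookup u h ≟ᵖ lookup T h) λ ne → none (h , ne)) u∈
    ... | yes (h , ne) = case C? (flipAt f u) of λ
        { (yes f∈) → reach T T∈ fit k (flipAt f u) f∈ (ℕ.<-≤-trans closer (ℕ.s≤s⁻¹ <k))
        ; (no f∉) → let o = u , u∈ , proj₂ (proj₂ next) , f∉ in
            contradiction (trans (osc-constant o u∈ v₀∈) (agrees o)) d }
      where
      next = adjacent u T (proj₁ (⇒⋂ u∈)) T∈ h ne
      f = proj₁ next
      d = proj₁ (proj₂ next)
      agrees : _∈osc_ G f C → lookup v₀ f ≡ lookup T f
      agrees o = case fit f of λ
        { (inj₁ z) → contradiction (trans (sym (osc-sample o)) z) (↑-nonzero _)
        ; (inj₂ eq) → ↑-injective (trans (sym (osc-sample o)) eq) }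
      flip-other : ∀ {a b} → a ≢ b → flipPM a ≡ b
      flip-other {⊕} {⊕} ne = contradiction refl ne
      flip-other {⊕} {⊖} _ = refl
      flip-other {⊖} {⊕} _ = refl
      flip-other {⊖} {⊖} ne = contradiction refl ne
      flipped : lookup (flipAt f u) f ≡ lookup T f
      flipped = trans (lookup∘updateAt f u) (flip-other d)
      closer : ∣ toSubset (differ?ᵖ (flipAt f u) T) ∣ ℕ.< ∣ toSubset (differ?ᵖ u T) ∣
      closer = toSubset-mono-< (differ?ᵖ (flipAt f u) T) (differ?ᵖ u T) (λ j dj → case j Fin.≟ f of λ
        { (yes refl) → contradiction flipped dj
        ; (no j≢f) → λ eq → dj (trans (lookup∘updateAt′ j f j≢f u) eq) }) f d λ df → df flipped

    consistent⇒∈ : ∀ T → G T → sample ≼ T → C T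
    consistent⇒∈ T T∈ fit = reach T T∈ fit _ v₀ v₀∈ ℕ.≤-refl

  open Convex

  ∈osc-resp : ∀ {C D e} → SameSet G C D → _∈osc_ G e C → _∈osc_ G e D
  ∈osc-resp same (u , u∈ , f∈ , f∉) = u , proj₁ (same u) u∈ , f∈ , λ f∈D → f∉ (proj₂ (same _) f∈D)

  entry-resp : ∀ C c D d → SameSet G C D → ∀ e → entry C c e ≡ entry D d e
  entry-resp C c D d same e with osc? C c e | osc? D d e
  ... | yes o | yes o' = cong ↑ (osc-constant C c o (v₀∈ C c) (proj₂ (same _) (v₀∈ D d)))
  ... | yes o | no ¬o' = contradiction (∈osc-resp {C} {D} same o) ¬o'
  ... | no ¬o | yes o' = contradiction (∈osc-resp {D} {C} (λ v → proj₂ (same v) , proj₁ (same v)) o') ¬o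
  ... | no _ | no _ = refl

  a : (C : Pred (PMVec n) 0ℓ) → IsConvex G C → Subset n
  a C c = α (sample C c)

  a-reconstructible : IsReconstructibleMap G a
  a-reconstructible =
      (λ C c D d same → cong α (tabulate-cong (entry-resp C c D d same)))
    , (λ C c → α-shattered (sample C c) (sample-realizable C c))
    , (λ C c e e∈ → sample-osc C c (α-support (sample C c) (sample-realizable C c) e e∈))
    -- The common point of the fibre: every D with this image has a sample that the decoded tope
    -- fits, and all topes fitting the sample of D lie in D.
    , λ C c → β (a C c) , λ D d eq → subst (λ W → D (β W)) eq
        (consistent⇒∈ D d _ (proj₂ (β-tope (sample D d) (sample-realizable D d)))
          (β-consistent (sample D d) (sample-realizable D d)))

theorem2 : (n : ℕ) (ℒ : List (SignVec n)) → IsOM ℒ → Simple ℒ →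
    HasReconstructibleMap (Topes ℒ)
    × ((d : ℕ) → IsVC (Topes ℒ) d → HasProperUSCS (Topes ℒ) d)
theorem2 n ℒ om simple = (a , a-reconstructible) , λ d vc → α , β , λ s r →
    -- The size bound holds because `α s` is shattered.
    proj₂ vc (α s) (α-shattered s r) , α-support s r , β-consistent s r , proj₂ (β-tope s r)
  where
  open Scheme ℒ om
  open Reconstruction ℒ om simple
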